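{- Assume the plus principle. Consider a pushout square of types given by maps $f : A \to B$, $g : A \to C$ with pushout $P = B +_A C$. Then the relative pushout product $\Delta f \mathbin{\square}_A \Delta g$ is acyclic if and only if it is contractible (i.e. all its fibers are contractible), and in that case the square is cartesian, i.e. the canonical map $A \to B \times_P C$ is an equivalence. This conclusion also holds if the absolute pushout product $\Delta f \mathbin{\square} \Delta g$ is acyclic.
   Context: We work in homotopy type theory (HoTT) in the style of the HoTT Book: dependent type theory with univalent universes (hence function extensionality) and higher inductive types such as pushouts and truncations; no classical axioms are assumed. The suspension $\Sigma A$ of a type $A$ is the pushout of $\mathbf{1} \leftarrow A \to \mathbf{1}$. A type is acyclic if its suspension is contractible; a map is acyclic if all its fibers are acyclic types. A type is simply connected if its $1$-truncation is contractible. The plus principle is the statement that every acyclic and simply connected type is contractible. For $f : A \to B$, $\Delta f : A \to A \times_B A$ denotes the diagonal $a \mapsto (a,a,\mathrm{refl})$. The (absolute) pushout product of maps $u : X \to Y$ and $v : Z \to W$ is the canonical map $u \mathbin{\square} v : (Y \times Z) +_{X \times Z} (X \times W) \to Y \times W$. The relative pushout product $\Delta f \mathbin{\square}_A \Delta g$ is the analogous map formed with products over $A$, where $A \times_B A$ and $A \times_C A$ are regarded as types over $A$ via first projection: it is the canonical map $$(A\times_B A) +_{A} (A \times_C A) \to (A \times_B A) \times_A (A \times_C A),$$ whose fiber over an element given by $a,a',a'':A$, $p : f(a) = f(a')$, $q : g(a) = g(a'')$ is the join of the fiber of $\Delta f$ at $(a,a',p)$ and the fiber of $\Delta g$ at $(a,a'',q)$.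 (The join $X * Y$ is the pushout of the projections $X \leftarrow X \times Y \to Y$.) -}

module Defs where

open import Data.Nat.Base using (ℕ; zero; suc)
open import Data.Product.Base using (Σ; _×_; _,_; proj₁; proj₂)
open import Data.Unit.Polymorphic.Base using (⊤; tt)
open import Level using (Level; Setω; _⊔_) renaming (suc to lsuc)
open import Relation.Binary.PropositionalEquality.Core using (_≡_; refl; sym; subst; subst₂)

-- Homotopy type theory is presented as the inner level of a two-level type
-- theory, because its identity types cannot be Agda's _≡_: by pattern matching
-- (axiom K) _≡_ is proof irrelevant, which refutes univalence.  The types of
-- the theory are the Agda types carrying a fibrancy structure Fib.  Π, Σ and
-- the unit type are Agda's own, so their rules hold definitionally; every
-- other former is given by its rules, and eliminates into fibrant families
-- only.  The relation _≡_ is strict equality: it appears exactly where the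
-- homotopy type theory of the HoTT Book has a judgmental computation rule.

record MLTT : Setω where
  field
    Fib : ∀ {ℓ} → Set ℓ → Set (lsuc ℓ)

  Type : ∀ ℓ → Set (lsuc ℓ)
  Type ℓ = Σ (Set ℓ) Fib

  El : ∀ {ℓ} → Type ℓ → Set ℓ
  El = proj₁

  field
    fib-Π : ∀ {a b} (A : Type a) (B : El A → Type b) → Fib ((x : El A) → El (B x))
    fib-Σ : ∀ {a b} (A : Type a) (B : El A → Type b) → Fib (Σ (El A) λ x → El (B x))
    fib-⊤ : ∀ {ℓ} → Fib (⊤ {ℓ})
    fib-𝒰 : ∀ ℓ → Fib (Type ℓ)

    Id   : ∀ {a} (A : Type a) → El A → El A → Type a
    idp  : ∀ {a} {A : Type a} {x : El A} → El (Id A x x)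
    J    : ∀ {a b} {A : Type a} {x : El A} (Q : (y : El A) → El (Id A x y) → Type b) →
           El (Q x idp) → ∀ {y} (p : El (Id A x y)) → El (Q y p)
    J-idp : ∀ {a b} {A : Type a} {x : El A} (Q : (y : El A) → El (Id A x y) → Type b)
            (d : El (Q x idp)) → J Q d idp ≡ d

    𝟘      : ∀ {ℓ} → Type ℓ
    𝟘-elim : ∀ {ℓ b} (Q : El (𝟘 {ℓ}) → Type b) → ∀ x → El (Q x)

    _⊕_    : ∀ {a b} → Type a → Type b → Type (a ⊔ b)
    left   : ∀ {a b} {A : Type a} {B : Type b} → El A → El (A ⊕ B)
    right  : ∀ {a b} {A : Type a} {B : Type b} → El B → El (A ⊕ B)
    ⊕-elim : ∀ {a b c} {A : Type a} {B : Type b} (Q : El (A ⊕ B) → Type c) →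
             (∀ x → El (Q (left x))) → (∀ y → El (Q (right y))) → ∀ z → El (Q z)
    ⊕-elim-left  : ∀ {a b c} {A : Type a} {B : Type b} (Q : El (A ⊕ B) → Type c)
                   (h : ∀ x → El (Q (left x))) (k : ∀ y → El (Q (right y))) →
                   ∀ x → ⊕-elim Q h k (left x) ≡ h x
    ⊕-elim-right : ∀ {a b c} {A : Type a} {B : Type b} (Q : El (A ⊕ B) → Type c)
                   (h : ∀ x → El (Q (left x))) (k : ∀ y → El (Q (right y))) →
                   ∀ y → ⊕-elim Q h k (right y) ≡ k y

    Nat      : Type Level.zero
    O        : El Nat
    S        : El Nat → El Nat
    Nat-elim : ∀ {b} (Q : El Nat → Type b) →
               El (Q O) → (∀ n → El (Q n) → El (Q (S n))) → ∀ n → El (Q n)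
    Nat-elim-O : ∀ {b} (Q : El Nat → Type b) (z : El (Q O))
                 (s : ∀ n → El (Q n) → El (Q (S n))) → Nat-elim Q z s O ≡ z
    Nat-elim-S : ∀ {b} (Q : El Nat → Type b) (z : El (Q O))
                 (s : ∀ n → El (Q n) → El (Q (S n))) →
                 ∀ n → Nat-elim Q z s (S n) ≡ s n (Nat-elim Q z s n)

module TypeTheory (T : MLTT) where
  open MLTT T public

  infixr 2 _⇒_ _×̇_
  infix  4 _≃_

  Π̇ : ∀ {a b} (A : Type a) → (El A → Type b) → Type (a ⊔ b)
  Π̇ A B = ((x : El A) → El (B x)) , fib-Π A B

  Σ̇ : ∀ {a b} (A : Type a) → (El A → Type b) → Type (a ⊔ b)
  Σ̇ A B = (Σ (El A) λ x → El (B x)) , fib-Σ A B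

  _⇒_ : ∀ {a b} → Type a → Type b → Type (a ⊔ b)
  A ⇒ B = Π̇ A λ _ → B

  _×̇_ : ∀ {a b} → Type a → Type b → Type (a ⊔ b)
  A ×̇ B = Σ̇ A λ _ → B

  𝟙 : ∀ {ℓ} → Type ℓ
  𝟙 = ⊤ , fib-⊤

  𝒰 : ∀ ℓ → Type (lsuc ℓ)
  𝒰 ℓ = Type ℓ , fib-𝒰 ℓ

  strict⇒Id : ∀ {a} (A : Type a) {x y : El A} → x ≡ y → El (Id A x y)
  strict⇒Id A refl = idp

  transport : ∀ {a b} {A : Type a} (Q : El A → Type b) {x y : El A} →
              El (Id A x y) → El (Q x) → El (Q y)
  transport Q {x} p u = J (λ y _ → Q y) u p

  transport-idp : ∀ {a b} {A : Type a} (Q : El A → Type b) {x : El A} (u : El (Q x)) →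
                  transport Q (idp {A = A} {x}) u ≡ u
  transport-idp Q u = J-idp (λ y _ → Q y) u

  apd : ∀ {a b} {A : Type a} (Q : El A → Type b) (h : (x : El A) → El (Q x))
        {x y : El A} (p : El (Id A x y)) → El (Id (Q y) (transport Q p (h x)) (h y))
  apd Q h {x} p =
    J (λ y p → Id (Q y) (transport Q p (h x)) (h y))
      (strict⇒Id (Q x) (transport-idp Q (h x))) p

  -- In a constant family, a path u = v induces a path from the transport of u to v.
  overConstant : ∀ {a b} {A : Type a} (D : Type b) {x y : El A} (p : El (Id A x y))
                 {u v : El D} → El (Id D u v) → El (Id D (transport (λ _ → D) p u) v)
  overConstant D p {u} {v} q =
    J (λ _ p → Id D (transport (λ _ → D) p u) v)
      (subst (λ w → El (Id D w v)) (sym (transport-idp (λ _ → D) u)) q) p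

  isContr : ∀ {a} → Type a → Type a
  isContr A = Σ̇ A λ c → Π̇ A λ x → Id A c x

  fiber : ∀ {a b} (A : Type a) (B : Type b) → (El A → El B) → El B → Type (a ⊔ b)
  fiber A B f y = Σ̇ A λ x → Id B (f x) y

  isContrMap : ∀ {a b} (A : Type a) (B : Type b) → (El A → El B) → Type (a ⊔ b)
  isContrMap A B f = Π̇ B λ y → isContr (fiber A B f y)

  isEquiv : ∀ {a b} (A : Type a) (B : Type b) → (El A → El B) → Type (a ⊔ b)
  isEquiv = isContrMap

  _≃_ : ∀ {a b} → Type a → Type b → Type (a ⊔ b)
  A ≃ B = Σ̇ (A ⇒ B) (isEquiv A B)

  idEquiv : ∀ {a} (A : Type a) → El (A ≃ A)
  idEquiv A = (λ x → x) , λ y → (y , idp) , λ where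
    (x , p) → J (λ y p → Id (fiber A A (λ x → x) y) (y , idp) (x , p)) idp p

  idToEquiv : ∀ {ℓ} (A B : Type ℓ) → El (Id (𝒰 ℓ) A B) → El (A ≃ B)
  idToEquiv A B = J (λ B _ → A ≃ B) (idEquiv A)

  -- Truncation levels are shifted by two: isTruncated n A says that A is an
  -- (n − 2)-type, starting from the contractible types at n = 0.
  isTruncated : ∀ {a} → ℕ → Type a → Type a
  isTruncated zero    A = isContr A
  isTruncated (suc n) A = Π̇ A λ x → Π̇ A λ y → isTruncated n (Id A x y)

record HoTT : Setω where
  field
    mltt : MLTT
  open TypeTheory mltt
  field
    univalence : ∀ {ℓ} (A B : Type ℓ) → El (isEquiv (Id (𝒰 ℓ) A B) (A ≃ B) (idToEquiv A B))

    Pushout : ∀ {ℓ} (A B C : Type ℓ) → (El A → El B) → (El A → El C) → Type ℓ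
    inl  : ∀ {ℓ} {A B C : Type ℓ} {f : El A → El B} {g : El A → El C} →
           El B → El (Pushout A B C f g)
    inr  : ∀ {ℓ} {A B C : Type ℓ} {f : El A → El B} {g : El A → El C} →
           El C → El (Pushout A B C f g)
    glue : ∀ {ℓ} {A B C : Type ℓ} {f : El A → El B} {g : El A → El C} →
           (x : El A) → El (Id (Pushout A B C f g) (inl (f x)) (inr (g x)))
    Pushout-elim :
      ∀ {ℓ q} {A B C : Type ℓ} {f : El A → El B} {g : El A → El C}
      (Q : El (Pushout A B C f g) → Type q)
      (h : (y : El B) → El (Q (inl y))) (k : (z : El C) → El (Q (inr z))) →
      ((x : El A) → El (Id (Q (inr (g x))) (transport Q (glue x) (h (f x))) (k (g x)))) →
      (w : El (Pushout A B C f g)) → El (Q w)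
    Pushout-elim-inl :
      ∀ {ℓ q} {A B C : Type ℓ} {f : El A → El B} {g : El A → El C}
      (Q : El (Pushout A B C f g) → Type q)
      (h : (y : El B) → El (Q (inl y))) (k : (z : El C) → El (Q (inr z)))
      (e : (x : El A) → El (Id (Q (inr (g x))) (transport Q (glue x) (h (f x))) (k (g x)))) →
      (y : El B) → Pushout-elim Q h k e (inl y) ≡ h y
    Pushout-elim-inr :
      ∀ {ℓ q} {A B C : Type ℓ} {f : El A → El B} {g : El A → El C}
      (Q : El (Pushout A B C f g) → Type q)
      (h : (y : El B) → El (Q (inl y))) (k : (z : El C) → El (Q (inr z)))
      (e : (x : El A) → El (Id (Q (inr (g x))) (transport Q (glue x) (h (f x))) (k (g x)))) →
      (z : El C) → Pushout-elim Q h k e (inr z) ≡ k z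
    -- As in the HoTT Book, this rule holds only up to a path; the substitutions
    -- along the two strict rules above make its two sides have the same type.
    Pushout-elim-glue :
      ∀ {ℓ q} {A B C : Type ℓ} {f : El A → El B} {g : El A → El C}
      (Q : El (Pushout A B C f g) → Type q)
      (h : (y : El B) → El (Q (inl y))) (k : (z : El C) → El (Q (inr z)))
      (e : (x : El A) → El (Id (Q (inr (g x))) (transport Q (glue x) (h (f x))) (k (g x)))) →
      (x : El A) →
      El (Id (Id (Q (inr (g x))) (transport Q (glue x) (h (f x))) (k (g x)))
             (subst₂ (λ u v → El (Id (Q (inr (g x))) (transport Q (glue x) u) v))
                     (Pushout-elim-inl Q h k e (f x)) (Pushout-elim-inr Q h k e (g x))
                     (apd Q (Pushout-elim Q h k e) (glue x)))
             (e x))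

    Trunc : ∀ {a} → ℕ → Type a → Type a
    ∣_∣ : ∀ {a} {n : ℕ} {A : Type a} → El A → El (Trunc n A)
    Trunc-isTruncated : ∀ {a} (n : ℕ) (A : Type a) → El (isTruncated n (Trunc n A))
    Trunc-elim :
      ∀ {a q} {n : ℕ} {A : Type a} (Q : El (Trunc n A) → Type q) →
      (∀ w → El (isTruncated n (Q w))) → (∀ x → El (Q ∣ x ∣)) → ∀ w → El (Q w)
    Trunc-elim-∣∣ :
      ∀ {a q} {n : ℕ} {A : Type a} (Q : El (Trunc n A) → Type q)
      (t : ∀ w → El (isTruncated n (Q w))) (h : ∀ x → El (Q ∣ x ∣)) →
      ∀ x → Trunc-elim Q t h ∣ x ∣ ≡ h x

module Homotopy (H : HoTT) where
  open HoTT H public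
  open TypeTheory mltt public

  Pushout-rec : ∀ {ℓ q} {A B C : Type ℓ} {f : El A → El B} {g : El A → El C} (D : Type q)
                (h : El B → El D) (k : El C → El D) →
                ((x : El A) → El (Id D (h (f x)) (k (g x)))) →
                El (Pushout A B C f g) → El D
  Pushout-rec D h k e = Pushout-elim (λ _ → D) h k λ x → overConstant D (glue x) (e x)

  Susp : ∀ {ℓ} → Type ℓ → Type ℓ
  Susp A = Pushout A 𝟙 𝟙 (λ _ → tt) (λ _ → tt)

  isAcyclic : ∀ {ℓ} → Type ℓ → Type ℓ
  isAcyclic A = isContr (Susp A)

  isAcyclicMap : ∀ {ℓ} (A B : Type ℓ) → (El A → El B) → Type ℓ
  isAcyclicMap A B f = Π̇ B λ y → isAcyclic (fiber A B f y)

  ∥_∥₁ : ∀ {ℓ} → Type ℓ → Type ℓ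
  ∥ A ∥₁ = Trunc 3 A

  isSimplyConnected : ∀ {ℓ} → Type ℓ → Type ℓ
  isSimplyConnected A = isContr ∥ A ∥₁

  PlusPrinciple : ∀ ℓ → Type (lsuc ℓ)
  PlusPrinciple ℓ = Π̇ (𝒰 ℓ) λ A → isAcyclic A ⇒ isSimplyConnected A ⇒ isContr A

  Pullback : ∀ {ℓ} (A B C : Type ℓ) → (El A → El C) → (El B → El C) → Type ℓ
  Pullback A B C f g = Σ̇ A λ x → Σ̇ B λ y → Id C (f x) (g y)

  KernelPair : ∀ {ℓ} (A B : Type ℓ) → (El A → El B) → Type ℓ
  KernelPair A B f = Pullback A A B f f

  Δ : ∀ {ℓ} (A B : Type ℓ) (f : El A → El B) → El A → El (KernelPair A B f)
  Δ A B f x = x , x , idp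

  module PushoutProduct {ℓ} (X Y Z W : Type ℓ) (u : El X → El Y) (v : El Z → El W) where

    dom cod : Type ℓ
    dom = Pushout (X ×̇ Z) (Y ×̇ Z) (X ×̇ W) (λ (x , z) → u x , z) (λ (x , z) → x , v z)
    cod = Y ×̇ W

    map : El dom → El cod
    map = Pushout-rec cod (λ (y , z) → y , v z) (λ (x , w) → u x , w) (λ _ → idp)

  module RelativeDiagonalPushoutProduct
    {ℓ} (A B C : Type ℓ) (f : El A → El B) (g : El A → El C) where

    dom cod : Type ℓ
    dom = Pushout A (KernelPair A B f) (KernelPair A C g) (Δ A B f) (Δ A C g)
    cod = Pullback (KernelPair A B f) (KernelPair A C g) A proj₁ proj₁

    map : El dom → El cod
    map = Pushout-rec cod
            (λ r → r , Δ A C g (proj₁ r) , idp)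
            (λ s → Δ A B f (proj₁ s) , s , idp)
            (λ _ → idp)

  gap : ∀ {ℓ} (A B C : Type ℓ) (f : El A → El B) (g : El A → El C) →
        El A → El (Pullback B C (Pushout A B C f g) inl inr)
  gap A B C f g x = f x , g x , glue x

  isCartesianPushoutSquare : ∀ {ℓ} (A B C : Type ℓ) → (El A → El B) → (El A → El C) → Type ℓ
  isCartesianPushoutSquare A B C f g =
    isEquiv A (Pullback B C (Pushout A B C f g) inl inr) (gap A B C f g)

{-# OPTIONS --safe #-}
module Submission where

open import Data.Nat.Base using (ℕ; zero; suc)
open import Data.Product.Base using (Σ; _×_; _,_; proj₁; proj₂)
open import Data.Unit.Polymorphic.Base using (tt)
open import Function.Bundles using (_⇔_; mk⇔)
open import Level using (Level; _⊔_) renaming (suc to lsuc)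
open import Relation.Binary.PropositionalEquality.Core using (_≡_; refl; cong; subst; subst₂)
  renaming (sym to ≡-sym; trans to ≡-trans)
open import Relation.Binary.PropositionalEquality.Properties using (subst-subst-sym; subst-sym-subst)
open import Defs

-- Fibers of (relative) pushout products are joins of identity types X and Y, so the first task is to show
-- that an acyclic join T of homogeneous types is contractible.  Acyclicity of T enters only through the fact
-- that every map from T to an identity type is constant.  Being contractible is a proposition, so T may be
-- assumed to have a point, say in X.
--   If Y is inhabited as well, T is simply connected, and the plus principle applies.  Constructively this is
-- the statement that any family P of propositions over X × Y that holds on the axes holds everywhere:
-- Friedman's translation turns the propositions that are stable under double negation relative to P (x₁ , y₁)
-- into a Boolean algebra, on which the translations of P act by commuting involutions, and a central action
-- of this kind defines a map from T to an identity type.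
--   If Y is not known to be inhabited, T is contractible as soon as Y is, hence maps out of T are maps out
-- of X; so the homogeneity of X gives a map from T to the self-equivalences of T, which is constant.
--   The square is then cartesian by the Blakers-Massey argument for the trivial modality: zigzags of length
-- three in the relation between B and C defined by A extend uniquely to squares, so zigzags of length one
-- are a code for the paths from inl to inr in the pushout.

-- Constancy holds only for maps into identity types, so a proposition has to be turned into
-- something invertible. Biimplication with a fixed proposition is an involution only classically;
-- stability supplies the classical logic. Ordinary double negation would prove only the double
-- negation of P (x₁ , y₁); with P (x₁ , y₁) itself as falsity, its double negation implies it. A
-- loop at one point does not act on the ambient type. The commuting family of loops is therefore
-- made part of the points of a larger type, where each loop becomes a self-homotopy of the
-- identity. In the Blakers-Massey part, filling zigzags compares two wedges of kernel pairs, over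
-- first and over second projections. The hypothesis concerns the first only; reversing paths yields
-- the second. Computation rules of `J` and of the eliminators are strict equalities but not
-- definitional, so values at reflexivity are recorded as separate lemmas and used by `rewrite` or
-- `subst`.

module Development (H : HoTT) where
  open Homotopy H

  private variable
    a b c d ℓ : Level

  -- Path algebra

  opaque
    trans : {A : Type a} {x y z : El A} → El (Id A x y) → El (Id A y z) → El (Id A x z)
    trans {A = A} {x} p q = J (λ z _ → Id A x z) p q

    trans-idp : {A : Type a} {x y : El A} (p : El (Id A x y)) → trans p idp ≡ p
    trans-idp {A = A} {x} p = J-idp (λ z _ → Id A x z) p

    sym : {A : Type a} {x y : El A} → El (Id A x y) → El (Id A y x)
    sym {A = A} {x} p = J (λ y _ → Id A y x) idp p

    sym-idp : {A : Type a} {x : El A} → sym (idp {A = A} {x}) ≡ idp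
    sym-idp {A = A} {x} = J-idp (λ y _ → Id A y x) idp

    ap : {A : Type a} {B : Type b} (f : El A → El B) {x y : El A} →
         El (Id A x y) → El (Id B (f x) (f y))
    ap {B = B} f {x} p = J (λ y _ → Id B (f x) (f y)) idp p

    ap-idp : {A : Type a} {B : Type b} (f : El A → El B) {x : El A} →
             ap {A = A} {B} f (idp {A = A} {x}) ≡ idp
    ap-idp {B = B} f {x} = J-idp (λ y _ → Id B (f x) (f y)) idp

  infix 4 _≈_
  _≈_ : {A : Type a} {x y : El A} → El (Id A x y) → El (Id A x y) → Type a
  _≈_ {A = A} {x} {y} p q = Id (Id A x y) p q

  ≡⇒≈ : {A : Type a} {x y : El A} {p q : El (Id A x y)} → p ≡ q → El (p ≈ q)
  ≡⇒≈ {A = A} {x} {y} = strict⇒Id (Id A x y)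

  infixl 6 _∙_
  _∙_ : {A : Type a} {x y z : El A} → El (Id A x y) → El (Id A y z) → El (Id A x z)
  _∙_ = trans

  idp-trans : {A : Type a} {x y : El A} (p : El (Id A x y)) → El (idp ∙ p ≈ p)
  idp-trans {A = A} {x} p = J (λ y p → Id (Id A x y) (idp ∙ p) p) (≡⇒≈ (trans-idp idp)) p

  ∙-assoc : {A : Type a} {x y z w : El A} (p : El (Id A x y)) (q : El (Id A y z)) (r : El (Id A z w)) →
            El (p ∙ q ∙ r ≈ p ∙ (q ∙ r))
  ∙-assoc {A = A} {x} p q r = J (λ w r → Id (Id A x w) (p ∙ q ∙ r) (p ∙ (q ∙ r))) base r
    where
      base : El (p ∙ q ∙ idp ≈ p ∙ (q ∙ idp))
      base rewrite trans-idp (p ∙ q) | trans-idp q = idp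

  sym-∙ : {A : Type a} {x y : El A} (p : El (Id A x y)) → El (sym p ∙ p ≈ idp)
  sym-∙ {A = A} p = J (λ y p → Id (Id A y y) (sym p ∙ p) idp) base p
    where
      base : ∀ {x} → El (Id (Id A x x) (sym idp ∙ idp) idp)
      base {x} rewrite trans-idp (sym (idp {A = A} {x})) | sym-idp {A = A} {x} = idp

  ∙-sym : {A : Type a} {x y : El A} (p : El (Id A x y)) → El (p ∙ sym p ≈ idp)
  ∙-sym {A = A} {x} p = J (λ y p → Id (Id A x x) (p ∙ sym p) idp) base p
    where
      base : El (Id (Id A x x) (idp ∙ sym idp) idp)
      base rewrite sym-idp {A = A} {x} | trans-idp (idp {A = A} {x}) = idp

  sym-sym : {A : Type a} {x y : El A} (p : El (Id A x y)) → El (sym (sym p) ≈ p)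
  sym-sym {A = A} {x} p = J (λ y p → Id (Id A x y) (sym (sym p)) p) base p
    where
      base : El (Id (Id A x x) (sym (sym idp)) idp)
      base rewrite sym-idp {A = A} {x} | sym-idp {A = A} {x} = idp

  _∙ˡ_ : {A : Type a} {x y z : El A} (p : El (Id A x y)) {q r : El (Id A y z)} →
         El (q ≈ r) → El (p ∙ q ≈ p ∙ r)
  p ∙ˡ s = ap (λ q → p ∙ q) s

  _∙ʳ_ : {A : Type a} {x y z : El A} {p q : El (Id A x y)} → El (p ≈ q) → (r : El (Id A y z)) →
         El (p ∙ r ≈ q ∙ r)
  s ∙ʳ r = ap (λ p → p ∙ r) s

  ∙-cancelˡ : {A : Type a} {x y z : El A} (p : El (Id A x y)) {q r : El (Id A y z)} →
              El (p ∙ q ≈ p ∙ r) → El (q ≈ r)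
  ∙-cancelˡ p {q} {r} s = sym (lem q) ∙ (sym p ∙ˡ s) ∙ lem r
    where
      lem : ∀ q → El (sym p ∙ (p ∙ q) ≈ q)
      lem q = sym (∙-assoc (sym p) p q) ∙ (sym-∙ p ∙ʳ q) ∙ idp-trans q

  ap-∙ : {A : Type a} {B : Type b} (f : El A → El B) {x y z : El A} (p : El (Id A x y)) (q : El (Id A y z)) →
         El (Id (Id B (f x) (f z)) (ap f (p ∙ q)) (ap f p ∙ ap f q))
  ap-∙ {A = A} {B} f {x} {y} p q =
    J (λ z q → Id (Id B (f x) (f z)) (ap f (p ∙ q)) (ap f p ∙ ap f q)) base q
    where
      base : El (Id (Id B (f x) (f y)) (ap f (p ∙ idp)) (ap f p ∙ ap f (idp {A = A} {y})))
      base rewrite trans-idp p | ap-idp {A = A} {B} f {y} | trans-idp (ap {A = A} {B} f p) = idp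

  ap-∘ : {A : Type a} {B : Type b} {C : Type c} (g : El B → El C) (f : El A → El B)
         {x y : El A} (p : El (Id A x y)) →
         El (Id (Id C (g (f x)) (g (f y))) (ap g (ap {B = B} f p)) (ap (λ x → g (f x)) p))
  ap-∘ {A = A} {B} {C} g f {x} p =
    J (λ y p → Id (Id C (g (f x)) (g (f y))) (ap g (ap {B = B} f p)) (ap (λ x → g (f x)) p)) base p
    where
      base : El (Id (Id C (g (f x)) (g (f x))) (ap g (ap {B = B} f (idp {A = A} {x}))) (ap (λ x → g (f x)) (idp {A = A} {x})))
      base rewrite ap-idp {A = A} {B} f {x} | ap-idp {A = B} {C} g {f x} | ap-idp {A = A} {C} (λ x → g (f x)) {x} = idp

  ap-id : {A : Type a} {x y : El A} (p : El (Id A x y)) → El (Id (Id A x y) (ap (λ x → x) p) p)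
  ap-id {A = A} {x} p = J (λ y p → Id (Id A x y) (ap (λ x → x) p) p) (≡⇒≈ (ap-idp (λ x → x))) p

  -- Paths in sums

  module _ (A : Type a) (B : El A → Type b) where
    overIdp : {x : El A} {u v : El (B x)} → El (Id (B x) u v) → El (Id (B x) (transport B idp u) v)
    overIdp {x} {u} {v} q = subst (λ w → El (Id (B x) w v)) (≡-sym (transport-idp {A = A} B u)) q

    overIdp⁻¹ : {x : El A} {u v : El (B x)} → El (Id (B x) (transport B idp u) v) → El (Id (B x) u v)
    overIdp⁻¹ {x} {u} {v} q = subst (λ w → El (Id (B x) w v)) (transport-idp {A = A} B u) q

    overIdp⁻¹-overIdp : {x : El A} {u v : El (B x)} (q : El (Id (B x) u v)) → overIdp⁻¹ {u = u} (overIdp {u = u} q) ≡ q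
    overIdp⁻¹-overIdp {u = u} q = subst-subst-sym (transport-idp {A = A} B u)

    opaque
      Σ-path : {x y : El A} {u : El (B x)} {v : El (B y)} (p : El (Id A x y)) →
               El (Id (B y) (transport B p u) v) → El (Id (Σ̇ A B) (x , u) (y , v))
      Σ-path {x} {u = u} {v} p =
        J (λ y p → Π̇ (B y) λ v → Id (B y) (transport B p u) v ⇒ Id (Σ̇ A B) (x , u) (y , v))
          (λ v q → ap (λ v → x , v) (overIdp⁻¹ {u = u} q)) p v

      Σ-path-idp : {x : El A} {u v : El (B x)} (q : El (Id (B x) (transport B idp u) v)) →
                   Σ-path {u = u} idp q ≡ ap (λ v → x , v) (overIdp⁻¹ {u = u} q)
      Σ-path-idp {x} {u} {v} q =
        cong (λ k → k v q)
          (J-idp (λ y p → Π̇ (B y) λ v → Id (B y) (transport B p u) v ⇒ Id (Σ̇ A B) (x , u) (y , v))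
                 (λ v q → ap (λ v → x , v) (overIdp⁻¹ {u = u} q)))

    ap-proj₁-Σ-path : {x y : El A} {u : El (B x)} {v : El (B y)} (p : El (Id A x y))
                      (q : El (Id (B y) (transport B p u) v)) →
                      El (Id (Id A x y) (ap {A = Σ̇ A B} proj₁ (Σ-path p q)) p)
    ap-proj₁-Σ-path {x} {u = u} {v} p =
      J (λ y p → Π̇ (B y) λ v → Π̇ (Id (B y) (transport B p u) v) λ q →
                 Id (Id A x y) (ap {A = Σ̇ A B} proj₁ (Σ-path {u = u} p q)) p) base p v
      where
        const : ∀ {v w} (q : El (Id (B x) v w)) → El (Id (Id A x x) (ap (λ _ → x) q) idp)
        const {v} q = J (λ w q → Id (Id A x x) (ap (λ _ → x) q) idp) (≡⇒≈ (ap-idp (λ _ → x))) q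
        base : ∀ v q → El (Id (Id A x x) (ap {A = Σ̇ A B} proj₁ (Σ-path {u = u} {v} idp q)) idp)
        base v q rewrite Σ-path-idp {u = u} q =
          ap-∘ proj₁ (λ v → x , v) (overIdp⁻¹ {u = u} q) ∙ const (overIdp⁻¹ {u = u} q)

  -- Propositions, contractibility and equivalences

  isProp : Type a → Type a
  isProp A = Π̇ A λ x → Π̇ A λ y → Id A x y

  isSet : Type a → Type a
  isSet A = Π̇ A λ x → Π̇ A λ y → isProp (Id A x y)

  contrPath : (A : Type a) → El (isContr A) → (x y : El A) → El (Id A x y)
  contrPath A (c , h) x y = sym (h x) ∙ h y

  isProp⇒isSet : (A : Type a) → El (isProp A) → El (isSet A)
  isProp⇒isSet A h x y p q = lem p ∙ sym (lem q)
    where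
      lem : ∀ {y} (p : El (Id A x y)) → El (p ≈ sym (h x x) ∙ h x y)
      lem p = J (λ y p → Id (Id A x y) p (sym (h x x) ∙ h x y)) (sym (sym-∙ (h x x))) p

  isContr-retract : (A : Type a) (B : Type b) (s : El A → El B) (r : El B → El A) →
                    ((x : El A) → El (Id A (r (s x)) x)) → El (isContr B) → El (isContr A)
  isContr-retract A B s r e (c , h) = r c , λ x → ap r (h (s x)) ∙ e x

  isContr-singleton : (A : Type a) (x : El A) → El (isContr (Σ̇ A λ y → Id A x y))
  isContr-singleton A x = (x , idp) , λ (y , p) → J (λ y p → Id (Σ̇ A λ y → Id A x y) (x , idp) (y , p)) idp p

  module _ {A : Type a} {B : Type b} where
    -- A self-map homotopic to the identity has fibers that are retracts of singletons,
    -- and the fibers of f are retracts of those of f ∘ g.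
    opaque
      quasiInverse⇒isEquiv : (f : El A → El B) (g : El B → El A) → ((x : El A) → El (Id A (g (f x)) x)) →
                             ((y : El B) → El (Id B (f (g y)) y)) → El (isEquiv A B f)
      quasiInverse⇒isEquiv f g η ε y =
        isContr-retract (fiber A B f y) (Σ̇ B λ z → Id B (f (g z)) y)
          (λ (x , p) → f x , ap f (η x) ∙ p)
          (λ (z , p) → g z , p)
          (λ (x , p) → Σ-path A (λ x → Id B (f x) y) (η x) (transport-fiber (η x) p))
          (isContr-retract (Σ̇ B λ z → Id B (f (g z)) y) (Σ̇ B λ z → Id B y z)
            (λ (z , p) → z , sym p ∙ ε z)
            (λ (z , p) → z , ε z ∙ sym p)
            (λ (z , p) → ap (λ p → z , p) (lem (ε z) p))
            (isContr-singleton B y))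
        where
          transport-fiber : ∀ {x x′} (q : El (Id A x x′)) (p : El (Id B (f x′) y)) →
                            El (transport (λ x → Id B (f x) y) q (ap f q ∙ p) ≈ p)
          transport-fiber {x} q =
            J (λ x′ q → Π̇ (Id B (f x′) y) λ p →
                 Id (Id B (f x′) y) (transport (λ x → Id B (f x) y) q (ap f q ∙ p)) p)
              (λ p → overIdp A (λ x → Id B (f x) y) (subst (λ r → El (r ∙ p ≈ p)) (≡-sym (ap-idp {A = A} f)) (idp-trans p)))
              q
          lem : ∀ {z w} (e : El (Id B w z)) (p : El (Id B w y)) → El (e ∙ sym (sym p ∙ e) ≈ p)
          lem {w = w} e p = J (λ z e → Id (Id B w y) (e ∙ sym (sym p ∙ e)) p) base e
            where
              base : El (idp ∙ sym (sym p ∙ idp) ≈ p)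
              base rewrite trans-idp (sym p) = idp-trans _ ∙ sym-sym p

  module _ {A : Type a} {B : Type b} (e : El (A ≃ B)) where
    inverse : El B → El A
    inverse y = proj₁ (proj₁ (proj₂ e y))

    inverse-right : (y : El B) → El (Id B (proj₁ e (inverse y)) y)
    inverse-right y = proj₂ (proj₁ (proj₂ e y))

    inverse-left : (x : El A) → El (Id A (inverse (proj₁ e x)) x)
    inverse-left x = ap proj₁ (proj₂ (proj₂ e (proj₁ e x)) (x , idp))

  mkEquiv : {A : Type a} {B : Type b} (f : El A → El B) (g : El B → El A) → ((x : El A) → El (Id A (g (f x)) x)) →
            ((y : El B) → El (Id B (f (g y)) y)) → El (A ≃ B)
  mkEquiv f g η ε = f , quasiInverse⇒isEquiv f g η ε

  symEquiv : {A : Type a} {B : Type b} → El (A ≃ B) → El (B ≃ A)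
  symEquiv e = mkEquiv (inverse e) (proj₁ e) (inverse-right e) (inverse-left e)

  compEquiv : {A : Type a} {B : Type b} {C : Type c} → El (A ≃ B) → El (B ≃ C) → El (A ≃ C)
  compEquiv e e′ = mkEquiv (λ x → proj₁ e′ (proj₁ e x)) (λ z → inverse e (inverse e′ z))
    (λ x → ap (inverse e) (inverse-left e′ (proj₁ e x)) ∙ inverse-left e x)
    (λ z → ap (proj₁ e′) (inverse-right e (inverse e′ z)) ∙ inverse-right e′ z)

  isEquiv-homotopic : {A : Type a} {B : Type b} (f g : El A → El B) → ((x : El A) → El (Id B (f x) (g x))) →
                      El (isEquiv A B f) → El (isEquiv A B g)
  isEquiv-homotopic f g h e = quasiInverse⇒isEquiv g (inverse (f , e))
    (λ x → ap (inverse (f , e)) (sym (h x)) ∙ inverse-left (f , e) x)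
    (λ y → sym (h _) ∙ inverse-right (f , e) y)

  isContr-equiv : (A : Type a) (B : Type b) → El (A ≃ B) → El (isContr B) → El (isContr A)
  isContr-equiv A B e = isContr-retract A B (proj₁ e) (inverse e) (inverse-left e)

  -- Consequences of univalence

  ua : {A B : Type ℓ} → El (A ≃ B) → El (Id (𝒰 ℓ) A B)
  ua {A = A} {B} e = proj₁ (proj₁ (univalence A B e))

  idToEquiv-ua : {A B : Type ℓ} (e : El (A ≃ B)) → El (Id (A ≃ B) (idToEquiv A B (ua e)) e)
  idToEquiv-ua {A = A} {B} e = proj₂ (proj₁ (univalence A B e))

  idToEquiv-idp : (A : Type ℓ) → idToEquiv A A idp ≡ idEquiv A
  idToEquiv-idp A = J-idp (λ B _ → A ≃ B) (idEquiv A)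

  equivInd : {A : Type ℓ} (Q : (B : Type ℓ) → El (A ≃ B) → Type c) → El (Q A (idEquiv A)) →
             {B : Type ℓ} (e : El (A ≃ B)) → El (Q B e)
  equivInd {A = A} Q q {B} e =
    transport (Q B) (idToEquiv-ua e)
      (J (λ B p → Q B (idToEquiv A B p)) (subst (λ e → El (Q A e)) (≡-sym (idToEquiv-idp A)) q) (ua e))

  -- Function extensionality

  -- This is how univalence yields function extensionality: by `equivInd` the equivalence may be
  -- taken to be the identity, and then the hypothesis is the conclusion.
  postcompose-injective : (X : Type a) {Y Z : Type ℓ} (e : El (Y ≃ Z)) (u v : El X → El Y) →
                          El (Id (X ⇒ Z) (λ x → proj₁ e (u x)) (λ x → proj₁ e (v x))) → El (Id (X ⇒ Y) u v)
  postcompose-injective X {Y} = equivInd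
    (λ Z e → Π̇ (X ⇒ Y) λ u → Π̇ (X ⇒ Y) λ v →
       Id (X ⇒ Z) (λ x → proj₁ e (u x)) (λ x → proj₁ e (v x)) ⇒ Id (X ⇒ Y) u v)
    (λ u v p → p)

  -- Both (f , f , idp) and (f , g , h) become f after the first projection from the path space of Y.
  nondependentFunext : (X : Type a) (Y : Type ℓ) (f g : El X → El Y) → ((x : El X) → El (Id Y (f x) (g x))) →
                       El (Id (X ⇒ Y) f g)
  nondependentFunext {ℓ = ℓ} X Y f g h =
    ap {A = X ⇒ Path} (λ u x → proj₁ (proj₂ (u x)))
       (postcompose-injective X source (λ x → f x , f x , idp) (λ x → f x , g x , h x) idp)
    where
      Path : Type ℓ
      Path = Σ̇ Y λ y → Σ̇ Y λ z → Id Y y z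
      source : El (Path ≃ Y)
      source = mkEquiv proj₁ (λ y → y , y , idp)
        (λ (y , z , p) → J (λ z p → Id Path (y , y , idp) (y , z , p)) idp p) (λ y → idp)

  -- By univalence and `nondependentFunext` the family is equal to the constant family `𝟙`, whose
  -- product is contractible definitionally.
  isContr-Π : (A : Type a) (B : El A → Type b) → ((x : El A) → El (isContr (B x))) → El (isContr (Π̇ A B))
  isContr-Π {b = b} A B h =
    transport {A = A ⇒ 𝒰 b} (λ B → isContr (Π̇ A B)) (sym B=𝟙) ((λ _ → tt) , λ _ → idp)
    where
      B=𝟙 : El (Id (A ⇒ 𝒰 b) B (λ _ → 𝟙))
      B=𝟙 = nondependentFunext A (𝒰 b) B (λ _ → 𝟙)
        (λ x → ua (mkEquiv (λ _ → tt) (λ _ → proj₁ (h x)) (proj₂ (h x)) (λ _ → idp)))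

  module _ (A : Type a) (B : El A → Type b) {f : (x : El A) → El (B x)} where
    private
      Homotopies : Type (a ⊔ b)
      Homotopies = Σ̇ (Π̇ A B) λ g → Π̇ A λ x → Id (B x) (f x) (g x)

      Homotopies-isContr : El (isContr Homotopies)
      Homotopies-isContr = isContr-retract Homotopies (Π̇ A λ x → Σ̇ (B x) λ y → Id (B x) (f x) y)
        (λ (g , h) x → g x , h x) (λ k → (λ x → proj₁ (k x)) , (λ x → proj₂ (k x))) (λ _ → idp)
        (isContr-Π A _ λ x → isContr-singleton (B x) (f x))

      path : (u : El Homotopies) → El (Id Homotopies (f , λ _ → idp) u)
      path u = contrPath Homotopies Homotopies-isContr (f , λ _ → idp) u

    opaque
      homotopyInd : (Q : (g : (x : El A) → El (B x)) → ((x : El A) → El (Id (B x) (f x) (g x))) → Type c) →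
                    El (Q f (λ _ → idp)) → ∀ {g} h → El (Q g h)
      homotopyInd Q q {g} h = transport {A = Homotopies} (λ (g , h) → Q g h) (path (g , h)) q

      -- `contrPath` composes two paths through the center, so at the base point `path` is an
      -- inverse followed by the same path, and it cancels whatever the contraction is.
      homotopyInd-idp : (Q : (g : (x : El A) → El (B x)) → ((x : El A) → El (Id (B x) (f x) (g x))) → Type c)
                        (q : El (Q f (λ _ → idp))) → El (Id (Q f (λ _ → idp)) (homotopyInd Q q (λ _ → idp)) q)
      homotopyInd-idp Q q =
        ap (λ p → transport {A = Homotopies} (λ (g , h) → Q g h) p q) (sym-∙ (proj₂ Homotopies-isContr (f , λ _ → idp)))
        ∙ strict⇒Id (Q f (λ _ → idp)) (transport-idp {A = Homotopies} (λ (g , h) → Q g h) q)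

    funext : ∀ {g} → ((x : El A) → El (Id (B x) (f x) (g x))) → El (Id (Π̇ A B) f g)
    funext = homotopyInd (λ g _ → Id (Π̇ A B) f g) idp

    funext-idp : El (funext (λ x → idp) ≈ idp)
    funext-idp = homotopyInd-idp (λ g _ → Id (Π̇ A B) f g) idp

  happly : {A : Type a} {B : El A → Type b} {f g : (x : El A) → El (B x)} → El (Id (Π̇ A B) f g) →
           (x : El A) → El (Id (B x) (f x) (g x))
  happly p x = ap (λ k → k x) p

  module _ {A : Type a} (B : El A → Type b) where
    happly-idp : (f : (x : El A) → El (B x)) →
                 El (Id (Π̇ A λ x → Id (B x) (f x) (f x)) (happly {B = B} (idp {A = Π̇ A B} {f})) (λ _ → idp))
    happly-idp f = funext A _ λ x → ≡⇒≈ (ap-idp {A = Π̇ A B} (λ k → k x))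

    happly-funext : {f g : (x : El A) → El (B x)} (h : (x : El A) → El (Id (B x) (f x) (g x))) →
                    El (Id (Π̇ A λ x → Id (B x) (f x) (g x)) (happly (funext A B h)) h)
    happly-funext {f} h =
      homotopyInd A B (λ g h → Id (Π̇ A λ x → Id (B x) (f x) (g x)) (happly (funext A B h)) h)
        (ap {A = Id (Π̇ A B) f f} happly (funext-idp A B) ∙ happly-idp f) h

    funext-happly : {f g : (x : El A) → El (B x)} (p : El (Id (Π̇ A B) f g)) → El (funext A B (happly p) ≈ p)
    funext-happly {f} p =
      J (λ g p → Id (Id (Π̇ A B) f g) (funext A B (happly p)) p)
        (ap {A = Π̇ A λ x → Id (B x) (f x) (f x)} (funext A B) (happly-idp f) ∙ funext-idp A B) p

  isProp-Π : (A : Type a) (B : El A → Type b) → ((x : El A) → El (isProp (B x))) → El (isProp (Π̇ A B))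
  isProp-Π A B h f g = funext A B λ x → h x (f x) (g x)

  isProp-isContr : (A : Type a) → El (isProp (isContr A))
  isProp-isContr A c@(x , h) (y , k) =
    Σ-path A (λ x → Π̇ A λ y → Id A x y) (h y)
      (isProp-Π A _ (λ z → isProp⇒isSet A (contrPath A c) _ _) _ _)

  isProp-isEquiv : (A : Type a) (B : Type b) (f : El A → El B) → El (isProp (isEquiv A B f))
  isProp-isEquiv A B f = isProp-Π B _ λ y → isProp-isContr (fiber A B f y)

  subtypePath : (A : Type a) (B : El A → Type b) → ((x : El A) → El (isProp (B x))) → {u v : El (Σ̇ A B)} →
                El (Id A (proj₁ u) (proj₁ v)) → El (Id (Σ̇ A B) u v)
  subtypePath A B h {u} {v} p = Σ-path A B p (h (proj₁ v) _ _)

  equivPath : {A : Type a} {B : Type b} {e e′ : El (A ≃ B)} → ((x : El A) → El (Id B (proj₁ e x) (proj₁ e′ x))) →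
              El (Id (A ≃ B) e e′)
  equivPath {A = A} {B} h = subtypePath (A ⇒ B) (isEquiv A B) (isProp-isEquiv A B) (funext A (λ _ → B) h)

  coe : {A B : Type ℓ} → El (Id (𝒰 ℓ) A B) → El A → El B
  coe {A = A} {B} p = proj₁ (idToEquiv A B p)

  coe-ua : {A B : Type ℓ} (e : El (A ≃ B)) (x : El A) → El (Id B (coe (ua e) x) (proj₁ e x))
  coe-ua {A = A} {B} e x = ap {A = A ≃ B} (λ e → proj₁ e x) (idToEquiv-ua e)

  idToEquiv-injective : {A B : Type ℓ} (p q : El (Id (𝒰 ℓ) A B)) →
                        El (Id (A ≃ B) (idToEquiv A B p) (idToEquiv A B q)) → El (p ≈ q)
  idToEquiv-injective {A = A} {B} p q r =
    sym (inverse-left u p) ∙ ap (inverse u) r ∙ inverse-left u q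
    where
      u : El (Id (𝒰 _) A B ≃ (A ≃ B))
      u = idToEquiv A B , univalence A B

  -- Pushouts

  -- The `glue` clause of a homotopy between maps out of a pushout becomes a commuting square
  -- without inverses.
  transport-Id : {A : Type a} {D : Type d} (f g : El A → El D) {x y : El A} (p : El (Id A x y))
                 {r : El (Id D (f x) (g x))} {s : El (Id D (f y) (g y))} →
                 El (Id (Id D (f x) (g y)) (ap f p ∙ s) (r ∙ ap g p)) →
                 El (transport (λ w → Id D (f w) (g w)) p r ≈ s)
  transport-Id {A = A} {D} f g {x} p {r} {s} =
    J (λ y p → Π̇ (Id D (f y) (g y)) λ s → Id (Id D (f x) (g y)) (ap f p ∙ s) (r ∙ ap g p) ⇒
               Id (Id D (f y) (g y)) (transport (λ w → Id D (f w) (g w)) p r) s) base p s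
    where
      base : ∀ s → El (Id (Id D (f x) (g x)) (ap f (idp {A = A} {x}) ∙ s) (r ∙ ap g (idp {A = A} {x}))) →
             El (Id (Id D (f x) (g x)) (transport {A = A} (λ w → Id D (f w) (g w)) idp r) s)
      base s h rewrite transport-idp {A = A} (λ w → Id D (f w) (g w)) {x} r
                     | ap-idp {A = A} {D} f {x} | ap-idp {A = A} {D} g {x} | trans-idp r =
        sym h ∙ idp-trans s

  ap-const : {A : Type a} {D : Type d} (c : El D) {x y : El A} (p : El (Id A x y)) →
             El (Id (Id D c c) (ap (λ _ → c) p) idp)
  ap-const {A = A} {D} c p = J (λ _ p → Id (Id D c c) (ap (λ _ → c) p) idp) (≡⇒≈ (ap-idp {A = A} {D} (λ _ → c))) p

  transport-Id-const : {A : Type a} {D : Type d} {c : El D} (g : El A → El D) {x y : El A} (p : El (Id A x y))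
                       {r : El (Id D c (g x))} {s : El (Id D c (g y))} → El (Id (Id D c (g y)) (r ∙ ap g p) s) →
                       El (transport (λ w → Id D c (g w)) p r ≈ s)
  transport-Id-const {c = c} g p {s = s} h = transport-Id (λ _ → c) g p ((ap-const c p ∙ʳ s) ∙ idp-trans s ∙ sym h)

  homotopy-natural : {A : Type a} {D : Type d} {c : El D} (g : El A → El D) (h : (x : El A) → El (Id D c (g x)))
                     {x y : El A} (p : El (Id A x y)) → El (Id (Id D c (g y)) (h x ∙ ap g p) (h y))
  homotopy-natural {A = A} {D} {c} g h {x} p = J (λ y p → Id (Id D c (g y)) (h x ∙ ap g p) (h y)) base p
    where
      base : El (Id (Id D c (g x)) (h x ∙ ap g (idp {A = A} {x})) (h x))
      base rewrite ap-idp {A = A} {D} g {x} | trans-idp (h x) = idp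

  module _ {A : Type a} (D : Type d) {x : El A} where
    overConstant-idp : {u v : El D} (r : El (Id D u v)) →
      overConstant {A = A} D (idp {x = x}) r ≡ subst (λ w → El (Id D w v)) (≡-sym (transport-idp {A = A} (λ _ → D) u)) r
    overConstant-idp {u} {v} r = J-idp (λ _ p → Id D (transport (λ _ → D) p u) v)
      (subst (λ w → El (Id D w v)) (≡-sym (transport-idp {A = A} (λ _ → D) u)) r)

    -- `Pushout-rec` is defined through `overConstant`, so its rule on `glue` first gives an
    -- equation between images under `overConstant`; this cancels it.
    overConstant-injective : {y : El A} (p : El (Id A x y)) {u v : El D} (r s : El (Id D u v)) →
                             El (overConstant D p r ≈ overConstant D p s) → El (r ≈ s)
    overConstant-injective p {u} {v} r s =
      J (λ y p → Id (Id D (transport (λ _ → D) p u) v) (overConstant D p r) (overConstant D p s) ⇒ Id (Id D u v) r s)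
        base p
      where
        strip : ∀ {u′} (e : u′ ≡ u) →
                El (Id (Id D u′ v) (subst (λ w → El (Id D w v)) (≡-sym e) r) (subst (λ w → El (Id D w v)) (≡-sym e) s)) →
                El (Id (Id D u v) r s)
        strip refl h = h
        base : El (overConstant {A = A} D (idp {x = x}) r ≈ overConstant {A = A} D (idp {x = x}) s) → El (r ≈ s)
        base rewrite overConstant-idp r | overConstant-idp s = strip (transport-idp {A = A} (λ _ → D) u)

    apd-const : (g : El A → El D) {y : El A} (p : El (Id A x y)) → El (apd (λ _ → D) g p ≈ overConstant D p (ap g p))
    apd-const g p =
      J (λ y p → Id (Id D (transport (λ _ → D) p (g x)) (g y)) (apd (λ _ → D) g p) (overConstant D p (ap g p))) base p
      where
        strip : ∀ {u′} (e : u′ ≡ g x) → strict⇒Id D e ≡ subst (λ w → El (Id D w (g x))) (≡-sym e) idp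
        strip refl = refl
        base : El (apd {A = A} (λ _ → D) g (idp {x = x}) ≈ overConstant {A = A} D (idp {x = x}) (ap {A = A} g idp))
        base rewrite ap-idp {A = A} {D} g {x} | overConstant-idp (idp {A = D} {g x}) =
          ≡⇒≈ (≡-trans (J-idp (λ y p → Id D (transport (λ _ → D) p (g x)) (g y))
                              (strict⇒Id D (transport-idp {A = A} (λ _ → D) (g x))))
                       (strip (transport-idp {A = A} (λ _ → D) (g x))))

  module _ {A B C : Type ℓ} {f : El A → El B} {g : El A → El C} (D : Type d)
           (h : El B → El D) (k : El C → El D) (e : (x : El A) → El (Id D (h (f x)) (k (g x)))) where
    private
      r : El (Pushout A B C f g) → El D
      r = Pushout-rec D h k e

    rec-inl : (y : El B) → r (inl y) ≡ h y
    rec-inl = Pushout-elim-inl (λ _ → D) h k (λ x → overConstant D (glue x) (e x))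

    rec-inr : (z : El C) → r (inr z) ≡ k z
    rec-inr = Pushout-elim-inr (λ _ → D) h k (λ x → overConstant D (glue x) (e x))

    -- The computation rule for ap r (glue x) as an induction principle, in which the strict
    -- equalities at the end points become reflexivity.
    rec-glueInd : ∀ {c} (x : El A)
      (Ψ : (u v : El D) → El (Id D u v) → u ≡ h (f x) → v ≡ k (g x) → Type c) →
      El (Ψ (h (f x)) (k (g x)) (e x) refl refl) →
      El (Ψ (r (inl (f x))) (r (inr (g x))) (ap r (glue x)) (rec-inl (f x)) (rec-inr (g x)))
    rec-glueInd x Ψ ψ = strip (rec-inl (f x)) (rec-inr (g x)) (ap r (glue x))
      (transport {A = Id D (transport (λ _ → D) (glue x) (r (inl (f x)))) (r (inr (g x)))}
        (λ s → Id (Id D (transport (λ _ → D) (glue x) (h (f x))) (k (g x)))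
                  (subst₂ (λ u v → El (Id D (transport (λ _ → D) (glue x) u) v)) (rec-inl (f x)) (rec-inr (g x)) s)
                  (overConstant D (glue x) (e x)))
        (apd-const D r (glue x))
        (Pushout-elim-glue (λ _ → D) h k (λ x → overConstant D (glue x) (e x)) x))
      where
        strip : ∀ {u v} (i : u ≡ h (f x)) (j : v ≡ k (g x)) (s : El (Id D u v)) →
                El (Id (Id D (transport (λ _ → D) (glue x) (h (f x))) (k (g x)))
                       (subst₂ (λ u v → El (Id D (transport (λ _ → D) (glue x) u) v)) i j (overConstant D (glue x) s))
                       (overConstant D (glue x) (e x))) →
                El (Ψ u v s i j)
        strip refl refl s w = transport (λ s → Ψ (h (f x)) (k (g x)) s refl refl)
          (sym (overConstant-injective D (glue x) s (e x) w)) ψ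

    rec-square : (x : El A) →
      El (Id (Id D (r (inl (f x))) (k (g x)))
             (strict⇒Id D (rec-inl (f x)) ∙ e x) (ap r (glue x) ∙ strict⇒Id D (rec-inr (g x))))
    rec-square x = rec-glueInd x
      (λ u v s i j → Id (Id D u (k (g x))) (strict⇒Id D i ∙ e x) (s ∙ strict⇒Id D j))
      (idp-trans (e x) ∙ sym (≡⇒≈ (trans-idp (e x))))

  -- Acyclic types

  -- The paths `h t` are the images of the meridians `glue t` under a map from the suspension to
  -- `D`. A contractible suspension is a set, so all meridians coincide.
  acyclic⇒constant : (T : Type ℓ) → El (isAcyclic T) → (D : Type d) (u v : El D) (h : El T → El (Id D u v)) →
                     (t t′ : El T) → El (h t ≈ h t′)
  acyclic⇒constant T acyclic D u v h t t′ =
    ∙-cancelˡ (strict⇒Id D (rec-inl D _ _ h tt))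
      (rec-square D (λ _ → u) (λ _ → v) h t
       ∙ ap (λ p → ap (Pushout-rec D (λ _ → u) (λ _ → v) h) p ∙ strict⇒Id D (rec-inr D _ _ h tt))
            (isProp⇒isSet (Susp T) (contrPath (Susp T) acyclic) _ _ (glue t) (glue t′))
       ∙ sym (rec-square D (λ _ → u) (λ _ → v) h t′))

  -- By univalence, self-equivalences of `E` form an identity type of the universe.
  acyclic⇒equivs-constant : (T : Type ℓ) → El (isAcyclic T) → (E : Type d) (m : El T → El (E ≃ E)) (t t′ : El T) →
                            El (Id (E ≃ E) (m t) (m t′))
  acyclic⇒equivs-constant T acyclic E m t t′ =
    sym (idToEquiv-ua (m t))
    ∙ ap (idToEquiv E E) (acyclic⇒constant T acyclic (𝒰 _) E E (λ t → ua (m t)) t t′)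
    ∙ idToEquiv-ua (m t′)

  propEquiv : {P Q : Type ℓ} → El (isProp P) → El (isProp Q) → (El P → El Q) → (El Q → El P) → El (P ≃ Q)
  propEquiv h k f g = mkEquiv f g (λ x → h _ x) (λ y → k _ y)

  -- A point of `T` makes `P` true, so there is a family over the suspension with values `𝟙` and `P`
  -- at the poles. Contractibility gives a path between the poles, along which `tt` is transported.
  acyclic⇒inhabited : (T : Type ℓ) → El (isAcyclic T) → (P : Type d) → El (isProp P) → (El T → El P) → El P
  acyclic⇒inhabited T acyclic P isPropP f =
    subst El (rec-inr (𝒰 _) _ _ e tt)
      (coe (ap F (contrPath (Susp T) acyclic (inl tt) (inr tt)))
        (subst El (≡-sym (rec-inl (𝒰 _) _ _ e tt)) tt))
    where
      e : El T → El (Id (𝒰 _) 𝟙 P)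
      e t = ua (propEquiv {P = 𝟙} (λ _ _ → idp) isPropP (λ _ → f t) (λ _ → tt))
      F : El (Susp T) → Type _
      F = Pushout-rec (𝒰 _) (λ _ → 𝟙) (λ _ → P) e

  Join : Type ℓ → Type ℓ → Type ℓ
  Join X Y = Pushout (X ×̇ Y) X Y proj₁ proj₂

  isProp-× : (A : Type a) (B : Type b) → El (isProp A) → El (isProp B) → El (isProp (A ×̇ B))
  isProp-× A B h k u v = subtypePath A (λ _ → B) (λ _ → k) (h _ _)

  isProp-isProp : (A : Type a) → El (isProp (isProp A))
  isProp-isProp A h = isProp-Π A _ (λ x → isProp-Π A _ λ y → isProp⇒isSet A h x y) h

  isProp-isSet : (A : Type a) → El (isProp (isSet A))
  isProp-isSet A = isProp-Π A _ λ x → isProp-Π A _ λ y → isProp-isProp (Id A x y)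

  isProp-from-inhabited : (A : Type a) → (El A → El (isProp A)) → El (isProp A)
  isProp-from-inhabited A h x = h x x

  -- A path is determined by the transport of reflexivity along it, and that transport lives in a
  -- proposition.
  reflexiveRelation⇒isSet : (A : Type a) (R : El A → El A → Type b) → (∀ x y → El (isProp (R x y))) →
                            (∀ x → El (R x x)) → (∀ x y → El (R x y) → El (Id A x y)) → El (isSet A)
  reflexiveRelation⇒isSet A R isPropR reflR f x y p q =
    lem p ∙ ap (λ r → sym (f x x (reflR x)) ∙ f x y r) (isPropR x y _ _) ∙ sym (lem q)
    where
      lem : ∀ {y} (p : El (Id A x y)) → El (p ≈ sym (f x x (reflR x)) ∙ f x y (transport (R x) p (reflR x)))
      lem = J (λ y p → Id (Id A x y) p (sym (f x x (reflR x)) ∙ f x y (transport (R x) p (reflR x)))) base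
        where
          base : El (Id (Id A x x) idp (sym (f x x (reflR x)) ∙ f x x (transport {A = A} (R x) idp (reflR x))))
          base rewrite transport-idp {A = A} (R x) {x} (reflR x) = sym (sym-∙ (f x x (reflR x)))

  -- Commuting loops parametrized by an acyclic join

  module _ {K : Type d} (X Y : Type ℓ) where

    Commute : (b : El K) → (El X → El Y → El (Id K b b)) → Type (d ⊔ ℓ)
    Commute b α = Π̇ X λ x → Π̇ Y λ y → Π̇ X λ x′ → Π̇ Y λ y′ → α x y ∙ α x′ y′ ≈ α x′ y′ ∙ α x y

    private
      -- The set condition makes the pair a proposition, so that a path between structures needs to
      -- compare only the loops.
      isGood : (b : El K) → (El X → El Y → El (Id K b b)) → Type (d ⊔ ℓ)
      isGood b α = Commute b α ×̇ isSet (Id K b b)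

      isProp-isGood : ∀ b α → El (isProp (isGood b α))
      isProp-isGood b α = isProp-from-inhabited (isGood b α) λ (_ , s) →
        isProp-× (Commute b α) (isSet (Id K b b))
          (isProp-Π X _ λ x → isProp-Π Y _ λ y → isProp-Π X _ λ x′ → isProp-Π Y _ λ y′ → s _ _)
          (isProp-isSet (Id K b b))

      Loops : El K → Type (d ⊔ ℓ)
      Loops b = X ⇒ Y ⇒ Id K b b

      Structure : El K → Type (d ⊔ ℓ)
      Structure b = Σ̇ (Loops b) (isGood b)

      E : Type (d ⊔ ℓ)
      E = Σ̇ K Structure

      overStructure : ∀ {b b′} (p : El (Id K b b′)) {u : El (Structure b)} {v : El (Structure b′)} →
                      (∀ x y → El (proj₁ u x y ∙ p ≈ p ∙ proj₁ v x y)) →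
                      El (Id (Structure b′) (transport Structure p u) v)
      overStructure {b} p {u} {v} =
        J (λ b′ p → Π̇ (Structure b′) λ v →
             (Π̇ X λ x → Π̇ Y λ y → proj₁ u x y ∙ p ≈ p ∙ proj₁ v x y) ⇒ Id (Structure b′) (transport Structure p u) v)
          (λ v h → overIdp K Structure (subtypePath (Loops b) (isGood b) (isProp-isGood b)
             (funext X _ λ x → funext Y _ λ y → ≡⇒≈ (≡-sym (trans-idp (proj₁ u x y))) ∙ h x y ∙ idp-trans (proj₁ v x y))))
          p v

      -- Transport along `α x y` conjugates the loops of the structure by `α x y`, which changes
      -- nothing because they commute with it.
      central : El X → El Y → (e : El E) → El (Id E e e)
      central x y (b , u@(α , commute , _)) =
        Σ-path K Structure (α x y) (overStructure (α x y) {u} {u} λ x′ y′ → commute x′ y′ x y)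

    -- The loops of each e : E commute, so they extend to loops at the point e of E that vary over E,
    -- and a join of such loops acts on E by equivalences.
    commuting-loops-trivial :
      El (isAcyclic (Join X Y)) → (b : El K) → El (isSet (Id K b b)) → (α : El X → El Y → El (Id K b b)) →
      El (Commute b α) → (x₀ : El X) (y₀ : El Y) →
      (∀ y → El (α x₀ y ≈ idp)) → (∀ x → El (α x y₀ ≈ idp)) → ∀ x y → El (α x y ≈ idp)
    commuting-loops-trivial acyclic b isSetLoops α commute x₀ y₀ α-left α-right x y =
      -- Triviality on the axes gives r y ≈ l x₀ ≈ r y₀ ≈ l x, so `square` leaves `α x y` between
      -- two equal paths.
      ∙-cancelˡ (l x) (square x y ∙ sym (l≈r x₀ y (α-left y)) ∙ l≈r x₀ y₀ (α-left y₀)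
                       ∙ sym (l≈r x y₀ (α-right x)) ∙ ≡⇒≈ (≡-sym (trans-idp (l x))))
      where
        T : Type _
        T = Join X Y
        n : El T → El E → El E
        n t e = Pushout-rec E (λ _ → e) (λ _ → e) (λ (x , y) → central x y e) t
        isEquiv-n : ∀ t → El (isEquiv E E (n t))
        isEquiv-n = Pushout-elim (λ t → isEquiv E E (n t))
          (λ x → isEquiv-homotopic (λ e → e) (n (inl x)) (λ e → strict⇒Id E (≡-sym (rec-inl E _ _ _ x))) (proj₂ (idEquiv E)))
          (λ y → isEquiv-homotopic (λ e → e) (n (inr y)) (λ e → strict⇒Id E (≡-sym (rec-inr E _ _ _ y))) (proj₂ (idEquiv E)))
          (λ _ → isProp-isEquiv E E _ _ _)
        e₀ : El E
        e₀ = b , α , commute , isSetLoops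
        N : El T → El K
        N t = proj₁ (n t e₀)
        -- Constancy is known for the equivalences `n t` as a whole; their value at `e₀`, projected
        -- to `K`, is all that is used.
        constant : ∀ t → El (Id K (N (inl x₀)) (N t))
        constant t = ap {A = E ≃ E} (λ m → proj₁ (proj₁ m e₀))
          (acyclic⇒equivs-constant T acyclic E (λ t → n t , isEquiv-n t) (inl x₀) t)
        i : ∀ x → El (Id E (n (inl x) e₀) e₀)
        i x = strict⇒Id E (rec-inl E _ _ _ x)
        j : ∀ y → El (Id E (n (inr y) e₀) e₀)
        j y = strict⇒Id E (rec-inr E _ _ _ y)
        l : ∀ x → El (Id K (N (inl x₀)) b)
        l x = constant (inl x) ∙ ap proj₁ (i x)
        r : ∀ y → El (Id K (N (inl x₀)) b)
        r y = constant (inr y) ∙ ap proj₁ (j y)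
        proj₁-square : ∀ x y → El (ap proj₁ (i x) ∙ α x y ≈ ap N (glue (x , y)) ∙ ap proj₁ (j y))
        proj₁-square x y =
          (ap proj₁ (i x) ∙ˡ sym (ap-proj₁-Σ-path K Structure (α x y) _))
          ∙ sym (ap-∙ proj₁ (i x) (central x y e₀))
          ∙ ap (ap {A = E} {B = K} proj₁) (rec-square E (λ _ → e₀) (λ _ → e₀) (λ (x , y) → central x y e₀) (x , y))
          ∙ ap-∙ proj₁ (ap (λ t → n t e₀) (glue (x , y))) (j y)
          ∙ (ap-∘ proj₁ (λ t → n t e₀) (glue (x , y)) ∙ʳ ap proj₁ (j y))
        square : ∀ x y → El (l x ∙ α x y ≈ r y)
        square x y =
          -- Naturality of `constant` along `glue (x , y)` absorbs the image of `glue` under `N`.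
          ∙-assoc (constant (inl x)) (ap proj₁ (i x)) (α x y)
          ∙ (constant (inl x) ∙ˡ proj₁-square x y)
          ∙ sym (∙-assoc (constant (inl x)) (ap N (glue (x , y))) (ap proj₁ (j y)))
          ∙ (homotopy-natural N constant (glue (x , y)) ∙ʳ ap proj₁ (j y))
        l≈r : ∀ x y → El (α x y ≈ idp) → El (l x ≈ r y)
        l≈r x y h = ≡⇒≈ (≡-sym (trans-idp (l x))) ∙ (l x ∙ˡ sym h) ∙ square x y

  -- Stable propositions

  propositionalExtensionality : {P Q : Type ℓ} → El (isProp P) → El (isProp Q) → (El P → El Q) → (El Q → El P) →
                                El (Id (𝒰 ℓ) P Q)
  propositionalExtensionality h k f g = ua (propEquiv h k f g)

  -- Excluded middle holds for the propositions R that are stable under double negation relative to P,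
  -- so they form a Boolean algebra, whose biimplication is a commutative group operation.
  module Stable (P : Type ℓ) where

    isStable : Type ℓ → Type ℓ
    isStable R = isProp R ×̇ (((R ⇒ P) ⇒ P) ⇒ R)

    isProp-isStable : (R : Type ℓ) → El (isProp (isStable R))
    isProp-isStable R = isProp-from-inhabited (isStable R) λ (h , _) →
      isProp-× (isProp R) (((R ⇒ P) ⇒ P) ⇒ R) (isProp-isProp R) (isProp-Π ((R ⇒ P) ⇒ P) _ λ _ → h)

    Ω : Type (lsuc ℓ)
    Ω = Σ̇ (𝒰 ℓ) isStable

    Ω-path : (R S : El Ω) → (El (proj₁ R) → El (proj₁ S)) → (El (proj₁ S) → El (proj₁ R)) → El (Id Ω R S)
    Ω-path (R , h , _) (S , k , _) f g = subtypePath (𝒰 ℓ) isStable isProp-isStable (propositionalExtensionality h k f g)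

    isSet-Ω : El (isSet Ω)
    isSet-Ω = reflexiveRelation⇒isSet Ω (λ (R , _) (S , _) → (R ⇒ S) ×̇ (S ⇒ R))
      (λ (R , h , _) (S , k , _) → isProp-× (R ⇒ S) (S ⇒ R) (isProp-Π R _ λ _ → k) (isProp-Π S _ λ _ → h))
      (λ R → (λ x → x) , (λ x → x))
      (λ R S (f , g) → Ω-path R S f g)

    _⟺_ : El Ω → El Ω → El Ω
    (R , h , s) ⟺ (Q , k , t) = ((R ⇒ Q) ×̇ (Q ⇒ R)) ,
      isProp-× (R ⇒ Q) (Q ⇒ R) (isProp-Π R _ λ _ → k) (isProp-Π Q _ λ _ → h) ,
      λ w → (λ r → t λ nq → w λ (f , _) → nq (f r)) , (λ q → s λ nr → w λ (_ , g) → nr (g q))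

    ⟺-involutive : (R Q : El Ω) → El (Id Ω ((R ⟺ Q) ⟺ Q) R)
    ⟺-involutive R@(R′ , _ , s) Q@(Q′ , _ , t) = Ω-path ((R ⟺ Q) ⟺ Q) R
      -- Refuting R refutes Q through `g`. Two refuted stable propositions are equivalent, so `f`
      -- yields Q, a contradiction. Falsity is P throughout, and stability gives ex falso.
      (λ (f , g) → s λ nr →
        let nq = λ q → nr (proj₂ (g q) q)
        in nq (f ((λ r → t λ _ → nr r) , (λ q → s λ _ → nq q))))
      (λ r → (λ (f , _) → f r) , (λ q → (λ _ → q) , (λ _ → r)))

    -- Associativity and commutativity of biimplication combined into the form needed: the actions
    -- of Q and S commute.
    ⟺-exchange : (R Q S : El Ω) → El (Id Ω ((R ⟺ Q) ⟺ S) ((R ⟺ S) ⟺ Q))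
    ⟺-exchange R Q S = Ω-path ((R ⟺ Q) ⟺ S) ((R ⟺ S) ⟺ Q) (exchange R Q S) (exchange R S Q)
      where
        exchange : (R Q S : El Ω) → El (proj₁ ((R ⟺ Q) ⟺ S)) → El (proj₁ ((R ⟺ S) ⟺ Q))
        exchange (R , _ , s) (Q , _ , t) (S , _ , u) (f , g) =
          (λ (rs , sr) → t λ nq →
            let nr = λ r → nq (proj₁ (g (rs r)) r)
            in nr (sr (f ((λ r → t λ _ → nr r) , (λ q → s λ _ → nq q))))) ,
          (λ q → (λ r → f ((λ _ → q) , (λ _ → r))) , (λ s → proj₂ (g s) q))

    ⟺-equiv : El Ω → El (Ω ≃ Ω)
    ⟺-equiv Q = mkEquiv (λ R → R ⟺ Q) (λ R → R ⟺ Q) (λ R → ⟺-involutive R Q) (λ R → ⟺-involutive R Q)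

    ¬¬_ : El (isProp P) → Type ℓ → El Ω
    (¬¬ h) S = ((S ⇒ P) ⇒ P) , (isProp-Π (S ⇒ P) _ λ _ → h) , λ k s → k λ r → r s

    true : El Ω
    true = 𝟙 , (λ _ _ → idp) , λ _ → tt

  isSet-Id-𝒰 : (A : Type ℓ) → El (isSet A) → El (isSet (Id (𝒰 ℓ) A A))
  isSet-Id-𝒰 A s = reflexiveRelation⇒isSet (Id (𝒰 _) A A) (λ p q → Π̇ A λ x → Id A (coe p x) (coe q x))
    (λ p q → isProp-Π A _ λ x → s _ _)
    (λ p x → idp)
    (λ p q h → idToEquiv-injective p q (equivPath h))

  coe-∙ : {A B C : Type ℓ} (p : El (Id (𝒰 ℓ) A B)) (q : El (Id (𝒰 ℓ) B C)) (x : El A) →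
          El (Id C (coe (p ∙ q) x) (coe q (coe p x)))
  coe-∙ {A = A} {B} p q x = J (λ C q → Id C (coe (p ∙ q) x) (coe q (coe p x))) base q
    where
      base : El (Id B (coe (p ∙ idp) x) (coe idp (coe p x)))
      base rewrite trans-idp p = strict⇒Id B (cong (λ e → proj₁ e (coe p x)) (≡-sym (idToEquiv-idp B)))

  ua-commute : {A : Type ℓ} (e e′ : El (A ≃ A)) →
               (∀ x → El (Id A (proj₁ e′ (proj₁ e x)) (proj₁ e (proj₁ e′ x)))) → El (ua e ∙ ua e′ ≈ ua e′ ∙ ua e)
  ua-commute {A = A} e e′ h = idToEquiv-injective (ua e ∙ ua e′) (ua e′ ∙ ua e) (equivPath λ x →
    coe-∙ (ua e) (ua e′) x ∙ ap (coe (ua e′)) (coe-ua e x) ∙ coe-ua e′ (proj₁ e x)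
    ∙ h x ∙ sym (coe-∙ (ua e′) (ua e) x ∙ ap (coe (ua e)) (coe-ua e′ x) ∙ coe-ua e (proj₁ e′ x)))

  ua-idp : {A : Type ℓ} (e : El (A ≃ A)) → (∀ x → El (Id A (proj₁ e x) x)) → El (ua e ≈ idp)
  ua-idp {A = A} e h = idToEquiv-injective (ua e) idp (equivPath λ x →
    coe-ua e x ∙ h x ∙ strict⇒Id A (cong (λ e → proj₁ e x) (≡-sym (idToEquiv-idp A))))

  -- Relative to P = S x₁ y₁, the double negations of S x y act on the stable propositions by biimplication.
  -- These actions are trivial where S x y holds, hence everywhere; at (x₁ , y₁) this says that P holds.
  acyclicJoin-propositions : (X Y : Type ℓ) → El (isAcyclic (Join X Y)) → (x₀ : El X) (y₀ : El Y)
    (S : El X → El Y → Type ℓ) → (∀ x y → El (isProp (S x y))) → (∀ y → El (S x₀ y)) → (∀ x → El (S x y₀)) →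
    ∀ x y → El (S x y)
  acyclicJoin-propositions {ℓ} X Y acyclic x₀ y₀ S isPropS S-left S-right x₁ y₁ =
    -- Since `true` is fixed by the action, `Q x₁ y₁` holds. It is the double negation of `S x₁ y₁`
    -- with falsity `S x₁ y₁`, so applying it to the identity gives `S x₁ y₁`.
    proj₁ (transport {A = Ω} proj₁ (sym fixed) tt) tt (λ s → s)
    where
      open Stable (S x₁ y₁)
      Q : El X → El Y → El Ω
      Q x y = (¬¬ isPropS x₁ y₁) (S x y)
      α : El X → El Y → El (Id (𝒰 _) Ω Ω)
      α x y = ua (⟺-equiv (Q x y))
      trivial : ∀ x y → El (S x y) → El (α x y ≈ idp)
      trivial x y s = ua-idp (⟺-equiv (Q x y)) λ R → Ω-path (R ⟺ Q x y) R
        (λ (_ , g) → g (λ k → k s)) (λ r → (λ _ k → k s) , (λ _ → r))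
      α-idp : El (α x₁ y₁ ≈ idp)
      α-idp = commuting-loops-trivial X Y acyclic Ω (isSet-Id-𝒰 Ω isSet-Ω) α
        (λ x y x′ y′ → ua-commute (⟺-equiv (Q x y)) (⟺-equiv (Q x′ y′)) λ R → ⟺-exchange R (Q x y) (Q x′ y′))
        x₀ y₀ (λ y → trivial x₀ y (S-left y)) (λ x → trivial x y₀ (S-right x)) x₁ y₁
      fixed : El (Id Ω (true ⟺ Q x₁ y₁) true)
      fixed = sym (coe-ua (⟺-equiv (Q x₁ y₁)) true) ∙ ap (λ p → coe p true) α-idp
        ∙ strict⇒Id Ω (cong (λ e → proj₁ e true) (idToEquiv-idp Ω))

  isTruncated-suc : (n : ℕ) (A : Type a) → El (isTruncated n A) → El (isTruncated (suc n) A)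
  isTruncated-suc zero A c x y = contrPath A c x y , λ p → isProp⇒isSet A (contrPath A c) x y _ p
  isTruncated-suc (suc n) A t x y = isTruncated-suc n (Id A x y) (t x y)

  -- The contraction is `k` on X and `γ x₀` on Y. Its coherence over `glue (x , y)` is `R x y`, an
  -- equation between paths in a 1-type and hence a proposition; by the choice of `k` it holds on
  -- both axes.
  acyclicJoin⇒simplyConnected : (X Y : Type ℓ) → El (isAcyclic (Join X Y)) → El X → El Y →
                                El (isSimplyConnected (Join X Y))
  acyclicJoin⇒simplyConnected X Y acyclic x₀ y₀ = center , Trunc-elim (λ w → Id Tr center w)
    (λ w → isTruncated-suc 2 (Id Tr center w) (Trunc-isTruncated 3 T center w))
    (Pushout-elim (λ t → Id Tr center ∣ t ∣) k (γ x₀)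
      (λ (x , y) → transport-Id-const ∣_∣ (glue (x , y)) (acyclicJoin-propositions X Y acyclic x₀ y₀ R
        (λ x y u v → proj₁ (Trunc-isTruncated 3 T _ _ _ _ u v)) R-left R-right x y)))
    where
      T Tr : Type _
      T = Join X Y
      Tr = ∥ T ∥₁
      center : El Tr
      center = ∣ inl x₀ ∣
      γ : ∀ x y → El (Id Tr ∣ inl x ∣ ∣ inr y ∣)
      γ x y = ap ∣_∣ (glue (x , y))
      k : ∀ x → El (Id Tr center ∣ inl x ∣)
      k x = γ x₀ y₀ ∙ sym (γ x y₀)
      R : El X → El Y → Type _
      R x y = k x ∙ γ x y ≈ γ x₀ y
      R-left : ∀ y → El (R x₀ y)
      R-left y = (∙-sym (γ x₀ y₀) ∙ʳ γ x₀ y) ∙ idp-trans (γ x₀ y)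
      R-right : ∀ x → El (R x y₀)
      R-right x = ∙-assoc (γ x₀ y₀) (sym (γ x y₀)) (γ x y₀) ∙ (γ x₀ y₀ ∙ˡ sym-∙ (γ x y₀)) ∙ ≡⇒≈ (trans-idp (γ x₀ y₀))

  -- Homogeneous types

  isHomogeneous : Type ℓ → Type ℓ
  isHomogeneous X = Π̇ X λ x → Π̇ X λ x′ → Σ̇ (X ≃ X) λ e → Id X (proj₁ e x) x′

  isHomogeneous-Id : (A : Type ℓ) (u v : El A) → El (isHomogeneous (Id A u v))
  isHomogeneous-Id A u v p p′ =
    mkEquiv (λ r → p′ ∙ sym p ∙ r) (λ r → p ∙ sym p′ ∙ r) (λ r → cancel p p′ r) (λ r → cancel p′ p r) ,
    ∙-assoc p′ (sym p) p ∙ (p′ ∙ˡ sym-∙ p) ∙ ≡⇒≈ (trans-idp p′)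
    where
      cancel : (p p′ r : El (Id A u v)) → El (p ∙ sym p′ ∙ (p′ ∙ sym p ∙ r) ≈ r)
      cancel p p′ r =
        sym (∙-assoc (p ∙ sym p′) (p′ ∙ sym p) r)
        ∙ ((sym (∙-assoc (p ∙ sym p′) p′ (sym p))
            ∙ ((∙-assoc p (sym p′) p′ ∙ (p ∙ˡ sym-∙ p′) ∙ ≡⇒≈ (trans-idp p)) ∙ʳ sym p)
            ∙ ∙-sym p) ∙ʳ r)
        ∙ idp-trans r

  Join-equivˡ : (X Y : Type ℓ) {X′ : Type ℓ} (e : El (X ≃ X′)) (x : El X) →
                El (Σ̇ (Join X Y ≃ Join X′ Y) λ e′ → Id (Join X′ Y) (proj₁ e′ (inl x)) (inl (proj₁ e x)))
  Join-equivˡ X Y = equivInd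
    (λ X′ e → Π̇ X λ x → Σ̇ (Join X Y ≃ Join X′ Y) λ e′ → Id (Join X′ Y) (proj₁ e′ (inl x)) (inl (proj₁ e x)))
    (λ x → idEquiv _ , idp)

  Join-equivʳ : (X Y : Type ℓ) {Y′ : Type ℓ} (e : El (Y ≃ Y′)) (y : El Y) →
                El (Σ̇ (Join X Y ≃ Join X Y′) λ e′ → Id (Join X Y′) (proj₁ e′ (inr y)) (inr (proj₁ e y)))
  Join-equivʳ X Y = equivInd
    (λ Y′ e → Π̇ Y λ y → Σ̇ (Join X Y ≃ Join X Y′) λ e′ → Id (Join X Y′) (proj₁ e′ (inr y)) (inr (proj₁ e y)))
    (λ y → idEquiv _ , idp)

  -- If T is contractible as soon as Y is inhabited, then a map out of the join of X and Y into T is a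
  -- map out of X; so a homogeneous X acts on T, and this action is constant because T is acyclic.
  module _ (T X Y : Type ℓ) (i : El X → El T)
           (extend : (M : El T → Type ℓ) (m : ∀ x → El (M (i x))) → (El Y → ∀ t → El (isContr (M t))) →
                     Σ (∀ t → El (M t)) λ s → ∀ x → s (i x) ≡ m x) where

    homogeneous-acyclic⇒contractible :
      El (isAcyclic T) → (El Y → El (isContr T)) → (x₀ : El X) →
      (∀ x → El (Σ̇ (T ≃ T) λ e → Id T (proj₁ e (i x₀)) (i x))) → El (isContr T)
    homogeneous-acyclic⇒contractible acyclic contr x₀ act = i x₀ ,
      proj₁ (extend (λ t → Id T (i x₀) t) path (λ y t → isTruncated-suc 0 T (contr y) (i x₀) t))
      where
        contr-≃ : El Y → El (isContr (T ≃ T))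
        contr-≃ y = idEquiv T , λ e → equivPath λ t → contrPath T (contr y) t (proj₁ e t)
        -- Constancy is available only for maps on all of `T`, so the action has to be extended from
        -- X first.
        extension = extend (λ _ → T ≃ T) (λ x → proj₁ (act x)) (λ y _ → contr-≃ y)
        constant : ∀ x → El (Id (T ≃ T) (proj₁ (act x₀)) (proj₁ (act x)))
        constant x = strict⇒Id (T ≃ T) (≡-sym (proj₂ extension x₀))
          ∙ acyclic⇒equivs-constant T acyclic T (proj₁ extension) (i x₀) (i x)
          ∙ strict⇒Id (T ≃ T) (proj₂ extension x)
        path : ∀ x → El (Id T (i x₀) (i x))
        path x = sym (proj₂ (act x₀)) ∙ ap {A = T ≃ T} (λ e → proj₁ e (i x₀)) (constant x) ∙ proj₂ (act x)

  acyclicJoin⇒contractible : El (PlusPrinciple ℓ) → (X Y : Type ℓ) → El (isHomogeneous X) → El (isHomogeneous Y) →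
                             El (isAcyclic (Join X Y)) → El (isContr (Join X Y))
  acyclicJoin⇒contractible plus X Y homX homY acyclic =
    acyclic⇒inhabited T acyclic (isContr T) (isProp-isContr T)
      (Pushout-elim (λ _ → isContr T)
        (λ x₀ → homogeneous-acyclic⇒contractible T X Y inl
          (λ M m c → Pushout-elim M m (λ y → proj₁ (c y (inr y))) (λ (x , y) → contrPath (M _) (c y (inr y)) _ _) ,
                     Pushout-elim-inl M m _ _)
          acyclic (contr x₀) x₀
          (λ x → let (e , p) = Join-equivˡ X Y (proj₁ (homX x₀ x)) x₀ in e , p ∙ ap inl (proj₂ (homX x₀ x))))
        (λ y₀ → homogeneous-acyclic⇒contractible T Y X inr
          (λ M m c → Pushout-elim M (λ x → proj₁ (c x (inl x))) m (λ (x , y) → contrPath (M _) (c x (inr y)) _ _) ,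
                     Pushout-elim-inr M _ m _)
          acyclic (λ x₀ → contr x₀ y₀) y₀
          (λ y → let (e , p) = Join-equivʳ X Y (proj₁ (homY y₀ y)) y₀ in e , p ∙ ap inr (proj₂ (homY y₀ y))))
        (λ _ → isProp-isContr T _ _))
    where
      T : Type _
      T = Join X Y
      contr : El X → El Y → El (isContr T)
      contr x₀ y₀ = plus T acyclic (acyclicJoin⇒simplyConnected X Y acyclic x₀ y₀)

  -- Fibers and total spaces

  strict⇒Id-subst : (A : Type a) {x y : El A} (e : x ≡ y) → strict⇒Id A e ≡ subst (λ z → El (Id A z y)) (≡-sym e) idp
  strict⇒Id-subst A refl = refl

  module _ (U : Type a) (D : Type b) (N : El D → Type c) (h : El U → El D) (pt : (u : El U) → El (N (h u))) where
    fromFiber : (d : El D) → El (fiber U D h d) → El (N d)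
    fromFiber d (u , p) = transport N p (pt u)

    -- The fiber of fromFiber d over n is a retract of the fiber over (d , n) of the total map.
    total-isEquiv⇒fromFiber-isEquiv : El (isEquiv U (Σ̇ D N) (λ u → h u , pt u)) →
                                      (d : El D) → El (isEquiv (fiber U D h d) (N d) (fromFiber d))
    total-isEquiv⇒fromFiber-isEquiv e d n =
      isContr-retract (F d n) (fiber U (Σ̇ D N) (λ u → h u , pt u) (d , n))
        (λ ((u , p) , w) → u , Σ-path D N p w)
        (λ (u , v) → r u v)
        (λ ((u , p) , w) → retraction u p n w)
        (e (d , n))
      where
        F : (d : El D) → El (N d) → Type _
        F d n = fiber (fiber U D h d) (N d) (fromFiber d) n
        r : (u : El U) → ∀ {d n} → El (Id (Σ̇ D N) (h u , pt u) (d , n)) → El (F d n)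
        r u v = J (λ (d , n) _ → F d n) ((u , idp) , strict⇒Id (N (h u)) (transport-idp {A = D} N (pt u))) v
        base : (u : El U) (n : El (N (h u))) (w : El (Id (N (h u)) (pt u) n)) →
               El (Id (F (h u) n) (r u (Σ-path D N idp (overIdp D N {u = pt u} w))) ((u , idp) , overIdp D N {u = pt u} w))
        base u n w rewrite Σ-path-idp D N {u = pt u} (overIdp D N {u = pt u} w) | overIdp⁻¹-overIdp D N {u = pt u} w =
          J (λ n w → Id (F (h u) n) (r u (ap {B = Σ̇ D N} (λ v → h u , v) w)) ((u , idp) , overIdp D N {u = pt u} w)) base′ w
          where
            base′ : El (Id (F (h u) (pt u)) (r u (ap {A = N (h u)} {B = Σ̇ D N} (λ v → h u , v) idp))
                           ((u , idp) , overIdp D N {u = pt u} idp))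
            base′ rewrite ap-idp {A = N (h u)} {B = Σ̇ D N} (λ v → h u , v) {pt u}
                        | J-idp {A = Σ̇ D N} (λ (d , n) _ → F d n)
                                ((u , idp) , strict⇒Id (N (h u)) (transport-idp {A = D} N (pt u)))
                        | strict⇒Id-subst (N (h u)) (transport-idp {A = D} N (pt u)) = idp
        base″ : (u : El U) (n : El (N (h u))) (w : El (Id (N (h u)) (transport {A = D} N idp (pt u)) n)) →
                El (Id (F (h u) n) (r u (Σ-path D N idp w)) ((u , idp) , w))
        base″ u n w = subst (λ w → El (Id (F (h u) n) (r u (Σ-path D N idp w)) ((u , idp) , w)))
          (subst-sym-subst (transport-idp {A = D} N (pt u))) (base u n (overIdp⁻¹ D N {u = pt u} w))
        retraction : (u : El U) → ∀ {d} (p : El (Id D (h u) d)) (n : El (N d)) (w : El (Id (N d) (transport N p (pt u)) n)) →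
                     El (Id (F d n) (r u (Σ-path D N p w)) ((u , p) , w))
        retraction u p = J (λ d p → Π̇ (N d) λ n → Π̇ (Id (N d) (transport N p (pt u)) n) λ w →
                              Id (F d n) (r u (Σ-path D N p w)) ((u , p) , w)) (base″ u) p

    fiberEquiv : El (isEquiv U (Σ̇ D N) (λ u → h u , pt u)) → (d : El D) → El (fiber U D h d ≃ N d)
    fiberEquiv e d = fromFiber d , total-isEquiv⇒fromFiber-isEquiv e d

  -- The action on points is recorded because an equivalence obtained from `homotopyInd` does not
  -- compute, and its value is needed later.
  fiber-homotopic : (A : Type a) (B : Type b) (f : El A → El B) {g : El A → El B} (h : (x : El A) → El (Id B (f x) (g x))) →
    (y : El B) → El (Σ̇ (fiber A B f y ≃ fiber A B g y) λ e →
                     Π̇ (fiber A B f y) λ (x , p) → Id (fiber A B g y) (proj₁ e (x , p)) (x , sym (h x) ∙ p))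
  fiber-homotopic A B f h = homotopyInd A (λ _ → B) {f}
    (λ g h → Π̇ B λ y → Σ̇ (fiber A B f y ≃ fiber A B g y) λ e →
             Π̇ (fiber A B f y) λ (x , p) → Id (fiber A B g y) (proj₁ e (x , p)) (x , sym (h x) ∙ p))
    (λ y → idEquiv (fiber A B f y) , λ (x , p) → ap (λ p → x , p) (lem p))
    h
    where
      lem : ∀ {x y} (p : El (Id B (f x) y)) → El (p ≈ sym idp ∙ p)
      lem {x} p rewrite sym-idp {A = B} {f x} = sym (idp-trans p)

  transport-Id-∘ : {A : Type a} {B : Type b} {D : Type d} (f : El B → El D) (f′ : El A → El B) (g : El A → El D)
                   {x y : El A} (p : El (Id A x y)) {r : El (Id D (f (f′ x)) (g x))} {s : El (Id D (f (f′ y)) (g y))} →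
                   El (Id (Id D (f (f′ x)) (g y)) (ap f (ap {B = B} f′ p) ∙ s) (r ∙ ap g p)) →
                   El (transport (λ w → Id D (f (f′ w)) (g w)) p r ≈ s)
  transport-Id-∘ f f′ g p {s = s} h = transport-Id (λ x → f (f′ x)) g p ((sym (ap-∘ f f′ p) ∙ʳ s) ∙ h)

  -- Fiberwise joins

  module _ {D : Type ℓ} (X Y : El D → Type ℓ) where
    private
      XY JXY : El D → Type ℓ
      XY d = X d ×̇ Y d
      JXY d = Join (X d) (Y d)
      ΣXY ΣX ΣY ΣJ U : Type ℓ
      ΣXY = Σ̇ D XY
      ΣX = Σ̇ D X
      ΣY = Σ̇ D Y
      ΣJ = Σ̇ D JXY

      toX : El ΣXY → El ΣX
      toX (d , x , y) = d , x
      toY : El ΣXY → El ΣY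
      toY (d , x , y) = d , y

      U = Pushout ΣXY ΣX ΣY toX toY

      toΣJ-inl : El ΣX → El ΣJ
      toΣJ-inl (d , x) = d , inl x
      toΣJ-inr : El ΣY → El ΣJ
      toΣJ-inr (d , y) = d , inr y
      toΣJ-glue : (t : El ΣXY) → El (Id ΣJ (toΣJ-inl (toX t)) (toΣJ-inr (toY t)))
      toΣJ-glue (d , x , y) = ap {B = ΣJ} (λ t → d , t) (glue (x , y))

      opaque
        toΣJ : El U → El ΣJ
        toΣJ = Pushout-rec ΣJ toΣJ-inl toΣJ-inr toΣJ-glue

        toΣJ-onInl : (b : El ΣX) → toΣJ (inl b) ≡ toΣJ-inl b
        toΣJ-onInl = rec-inl ΣJ toΣJ-inl toΣJ-inr toΣJ-glue

        toΣJ-onInr : (c : El ΣY) → toΣJ (inr c) ≡ toΣJ-inr c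
        toΣJ-onInr = rec-inr ΣJ toΣJ-inl toΣJ-inr toΣJ-glue

        toΣJ-glueInd : (t : El ΣXY)
          (Ψ : (u v : El ΣJ) → El (Id ΣJ u v) → u ≡ toΣJ-inl (toX t) → v ≡ toΣJ-inr (toY t) → Type c) →
          El (Ψ (toΣJ-inl (toX t)) (toΣJ-inr (toY t)) (toΣJ-glue t) refl refl) →
          El (Ψ (toΣJ (inl (toX t))) (toΣJ (inr (toY t))) (ap toΣJ (glue t)) (toΣJ-onInl (toX t)) (toΣJ-onInr (toY t)))
        toΣJ-glueInd = rec-glueInd ΣJ toΣJ-inl toΣJ-inr toΣJ-glue

      module From (d : El D) where
        fromJ-inl : El (X d) → El U
        fromJ-inl x = inl (d , x)
        fromJ-inr : El (Y d) → El U
        fromJ-inr y = inr (d , y)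
        fromJ-glue : (t : El (XY d)) → El (Id U (fromJ-inl (proj₁ t)) (fromJ-inr (proj₂ t)))
        fromJ-glue (x , y) = glue (d , x , y)

        fromJ : El (JXY d) → El U
        fromJ = Pushout-rec U fromJ-inl fromJ-inr fromJ-glue
      open From

      fromΣJ : El ΣJ → El U
      fromΣJ (d , t) = fromJ d t

      -- In the three homotopies below the two sides agree strictly on points, and rec-glueInd
      -- turns the squares over glue into identities between reflexivities and glue.
      from-glue : ∀ d (x : El (X d)) (y : El (Y d)) → El (Id (Id U (fromJ d (inl x)) (inr (d , y)))
        (ap fromΣJ (toΣJ-glue (d , x , y)) ∙ strict⇒Id U (rec-inr U _ _ (fromJ-glue d) y))
        (strict⇒Id U (rec-inl U _ _ (fromJ-glue d) x) ∙ ap (λ u → u) (glue (d , x , y))))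
      from-glue d x y =
        (ap-∘ fromΣJ (λ t → d , t) (glue (x , y)) ∙ʳ strict⇒Id U (rec-inr U _ _ (fromJ-glue d) y))
        ∙ rec-glueInd U (fromJ-inl d) (fromJ-inr d) (fromJ-glue d) (x , y)
            (λ u v s i j → Id (Id U u (inr (d , y)))
               (s ∙ strict⇒Id U j) (strict⇒Id U i ∙ ap (λ u → u) (glue (d , x , y))))
            (≡⇒≈ (trans-idp (glue (d , x , y))) ∙ sym (ap-id (glue (d , x , y)))
             ∙ sym (idp-trans (ap (λ u → u) (glue (d , x , y)))))

      from-to-inl : ∀ d x → fromΣJ (toΣJ (inl (d , x))) ≡ inl (d , x)
      from-to-inl d x = ≡-trans (cong fromΣJ (toΣJ-onInl (d , x))) (rec-inl U _ _ (fromJ-glue d) x)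

      from-to-inr : ∀ d y → fromΣJ (toΣJ (inr (d , y))) ≡ inr (d , y)
      from-to-inr d y = ≡-trans (cong fromΣJ (toΣJ-onInr (d , y))) (rec-inr U _ _ (fromJ-glue d) y)

      from-to-glue : ∀ d x y → El (Id (Id U (fromΣJ (toΣJ (inl (d , x)))) (inr (d , y)))
        (ap fromΣJ (ap {B = ΣJ} toΣJ (glue (d , x , y))) ∙ strict⇒Id U (from-to-inr d y))
        (strict⇒Id U (from-to-inl d x) ∙ ap (λ u → u) (glue (d , x , y))))
      from-to-glue d x y = toΣJ-glueInd (d , x , y)
        (λ u v s i j → Id (Id U (fromΣJ u) (inr (d , y)))
           (ap {B = U} fromΣJ s ∙ strict⇒Id U (≡-trans (cong fromΣJ j) (rec-inr U _ _ (fromJ-glue d) y)))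
           (strict⇒Id U (≡-trans (cong fromΣJ i) (rec-inl U _ _ (fromJ-glue d) x)) ∙ ap (λ u → u) (glue (d , x , y))))
        (from-glue d x y)

      from-to : (u : El U) → El (Id U (fromΣJ (toΣJ u)) u)
      from-to = Pushout-elim (λ u → Id U (fromΣJ (toΣJ u)) u)
        (λ (d , x) → strict⇒Id U (from-to-inl d x))
        (λ (d , y) → strict⇒Id U (from-to-inr d y))
        (λ (d , x , y) → transport-Id-∘ fromΣJ toΣJ (λ u → u) (glue (d , x , y)) (from-to-glue d x y))

      to-from : (w : El ΣJ) → El (Id ΣJ (toΣJ (fromΣJ w)) w)
      to-from (d , t) = Pushout-elim (λ t → Id ΣJ (toΣJ (fromJ d t)) (d , t))
        (λ x → strict⇒Id ΣJ (≡-trans (cong toΣJ (rec-inl U _ _ (fromJ-glue d) x)) (toΣJ-onInl (d , x))))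
        (λ y → strict⇒Id ΣJ (≡-trans (cong toΣJ (rec-inr U _ _ (fromJ-glue d) y)) (toΣJ-onInr (d , y))))
        (λ (x , y) → transport-Id-∘ toΣJ (fromJ d) (λ t → d , t) (glue (x , y))
          (rec-glueInd U (fromJ-inl d) (fromJ-inr d) (fromJ-glue d) (x , y)
               (λ u v s i j → Id (Id ΣJ (toΣJ u) (d , inr y))
                  (ap {B = ΣJ} toΣJ s ∙ strict⇒Id ΣJ (≡-trans (cong toΣJ j) (toΣJ-onInr (d , y))))
                  (strict⇒Id ΣJ (≡-trans (cong toΣJ i) (toΣJ-onInl (d , x))) ∙ toΣJ-glue (d , x , y)))
               (toΣJ-glueInd (d , x , y)
                  (λ u v s i j → Id (Id ΣJ u (d , inr y)) (s ∙ strict⇒Id ΣJ j) (strict⇒Id ΣJ i ∙ toΣJ-glue (d , x , y)))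
                  (≡⇒≈ (trans-idp (toΣJ-glue (d , x , y))) ∙ sym (idp-trans (toΣJ-glue (d , x , y)))))))
        t

      r-glue : (t : El ΣXY) → El (Id D (proj₁ (toX t)) (proj₁ (toY t)))
      r-glue t = idp

      r : El U → El D
      r = Pushout-rec D proj₁ proj₁ r-glue

      proj₁-toΣJ : (u : El U) → El (Id D (proj₁ (toΣJ u)) (r u))
      proj₁-toΣJ = Pushout-elim (λ u → Id D (proj₁ (toΣJ u)) (r u))
        (λ b → strict⇒Id D (≡-trans (cong proj₁ (toΣJ-onInl b)) (≡-sym (rec-inl D _ _ r-glue b))))
        (λ c → strict⇒Id D (≡-trans (cong proj₁ (toΣJ-onInr c)) (≡-sym (rec-inr D _ _ r-glue c))))
        (λ t@(d , x , y) → transport-Id-∘ proj₁ toΣJ r (glue t)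
          (toΣJ-glueInd t
               (λ u v s i j → Id (Id D (proj₁ u) (r (inr (toY t))))
                  (ap {B = D} proj₁ s ∙ strict⇒Id D (≡-trans (cong proj₁ j) (≡-sym (rec-inr D _ _ r-glue (toY t)))))
                  (strict⇒Id D (≡-trans (cong proj₁ i) (≡-sym (rec-inl D _ _ r-glue (toX t)))) ∙ ap r (glue t)))
               (rec-glueInd D proj₁ proj₁ r-glue t
                  (λ u v s i j → Id (Id D d v)
                    (ap {B = D} proj₁ (toΣJ-glue t) ∙ strict⇒Id D (≡-sym j)) (strict⇒Id D (≡-sym i) ∙ s))
                  (≡⇒≈ (trans-idp (ap {B = D} proj₁ (toΣJ-glue t))) ∙ ap-∘ proj₁ (λ t → d , t) (glue (x , y))
                   ∙ ap-const d (glue (x , y)) ∙ sym (idp-trans idp)))))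

    -- Sums commute with pushouts, so `U` is the total space of the fiberwise join; `proj₁-toΣJ`
    -- identifies its first projection with the recursor `r`.
    Σ-Join-fiber : (d : El D) → El (fiber U D r d ≃ JXY d)
    Σ-Join-fiber d = compEquiv
      (symEquiv (proj₁ (fiber-homotopic U D (λ u → proj₁ (toΣJ u)) proj₁-toΣJ d)))
      (fiberEquiv U D JXY (λ u → proj₁ (toΣJ u)) (λ u → proj₂ (toΣJ u))
        (quasiInverse⇒isEquiv toΣJ fromΣJ from-to to-from) d)

  module _ {D : Type ℓ} (X Y : El D → Type ℓ) where
    private
      ΣXY ΣX ΣY : Type ℓ
      ΣXY = Σ̇ D λ d → X d ×̇ Y d
      ΣX = Σ̇ D X
      ΣY = Σ̇ D Y

      toX : El ΣXY → El ΣX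
      toX (d , x , y) = d , x
      toY : El ΣXY → El ΣY
      toY (d , x , y) = d , y

      module _ (A B C : Type ℓ) (α : El ΣXY → El A) (β : El ΣX → El B) (γ : El ΣY → El C)
               (f : El A → El B) (g : El A → El C) (h : El B → El D) (k : El C → El D)
               (f-path : ∀ t → El (Id B (β (toX t)) (f (α t)))) (g-path : ∀ t → El (Id C (γ (toY t)) (g (α t))))
               (h-path : ∀ x → El (Id D (proj₁ x) (h (β x)))) (k-path : ∀ y → El (Id D (proj₁ y) (k (γ y)))) where

        -- Pasting `e` with the four comparison homotopies must give the trivial homotopy of the
        -- square of total spaces over `D`.
        Coherent : ((x : El A) → El (Id D (h (f x)) (k (g x)))) → Type ℓ
        Coherent e = Π̇ ΣXY λ t → Id (Id D (proj₁ t) (k (g (α t))))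
          (h-path (toX t) ∙ ap h (f-path t) ∙ e (α t)) (k-path (toY t) ∙ ap k (g-path t))

        FiberJoin : ((x : El A) → El (Id D (h (f x)) (k (g x)))) → Type ℓ
        FiberJoin e = Π̇ D λ d → fiber (Pushout A B C f g) D (Pushout-rec D h k e) d ≃ Join (X d) (Y d)

        Conclusion : Type ℓ
        Conclusion = Π̇ (Π̇ A λ x → Id D (h (f x)) (k (g x))) λ e → Coherent e ⇒ FiberJoin e

      Goal : (A B C : Type ℓ) → (El ΣXY → El A) → (El ΣX → El B) → (El ΣY → El C) → Type ℓ
      Goal A B C α β γ =
        Π̇ (A ⇒ B) λ f → Π̇ (A ⇒ C) λ g → Π̇ (B ⇒ D) λ h → Π̇ (C ⇒ D) λ k →
        Π̇ (Π̇ ΣXY λ t → Id B (β (toX t)) (f (α t))) λ f-path →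
        Π̇ (Π̇ ΣXY λ t → Id C (γ (toY t)) (g (α t))) λ g-path →
        Π̇ (Π̇ ΣX λ x → Id D (proj₁ x) (h (β x))) λ h-path →
        Π̇ (Π̇ ΣY λ y → Id D (proj₁ y) (k (γ y))) λ k-path →
        Conclusion A B C α β γ f g h k f-path g-path h-path k-path

      base : El (Goal ΣXY ΣX ΣY (λ t → t) (λ x → x) (λ y → y))
      base f g h k f-path g-path h-path k-path =
        homotopyInd ΣXY (λ _ → ΣX) {toX}
          (λ f f-path → Conclusion ΣXY ΣX ΣY (λ t → t) (λ x → x) (λ y → y) f g h k f-path g-path h-path k-path)
          (homotopyInd ΣXY (λ _ → ΣY) {toY}
            (λ g g-path → Conclusion ΣXY ΣX ΣY (λ t → t) (λ x → x) (λ y → y) toX g h k (λ _ → idp) g-path h-path k-path)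
            (homotopyInd ΣX (λ _ → D) {proj₁}
              (λ h h-path → Conclusion ΣXY ΣX ΣY (λ t → t) (λ x → x) (λ y → y) toX toY h k (λ _ → idp) (λ _ → idp) h-path k-path)
              (homotopyInd ΣY (λ _ → D) {proj₁}
                (λ k k-path → Conclusion ΣXY ΣX ΣY (λ t → t) (λ x → x) (λ y → y) toX toY proj₁ k
                                (λ _ → idp) (λ _ → idp) (λ _ → idp) k-path)
                strictCase k-path)
              h-path)
            g-path)
          f-path
        where
          strictCase : El (Conclusion ΣXY ΣX ΣY (λ t → t) (λ x → x) (λ y → y) toX toY proj₁ proj₁
                             (λ _ → idp) (λ _ → idp) (λ _ → idp) (λ _ → idp))
          -- Once the comparison homotopies are reflexivities, coherence says that `e` is trivial,
          -- which is the case of `Σ-Join-fiber`.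
          strictCase e coherent =
            homotopyInd ΣXY (λ t → Id D (proj₁ t) (proj₁ t)) {λ _ → idp}
              (λ e _ → FiberJoin ΣXY ΣX ΣY (λ t → t) (λ x → x) (λ y → y) toX toY proj₁ proj₁
                         (λ _ → idp) (λ _ → idp) (λ _ → idp) (λ _ → idp) e)
              (Σ-Join-fiber X Y)
              (λ t → sym (lem t (e t) (coherent t)))
            where
              lem : ∀ t (p : El (Id D (proj₁ t) (proj₁ t))) →
                    El (Id (Id D (proj₁ t) (proj₁ t))
                         (idp ∙ ap {A = ΣX} proj₁ (idp {x = toX t}) ∙ p) (idp ∙ ap {A = ΣY} proj₁ (idp {x = toY t}))) →
                    El (p ≈ idp)
              lem t p rewrite ap-idp {A = ΣX} {D} proj₁ {toX t} | ap-idp {A = ΣY} {D} proj₁ {toY t}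
                            | trans-idp (idp {A = D} {proj₁ t}) = λ w → sym (idp-trans p) ∙ w

    -- A recognition principle: a span equivalent to that of the total spaces of `X` and `Y`,
    -- compatibly over `D`, has joins as the fibers of its induced map. Induction on the
    -- equivalences and homotopies reduces everything to the strict case.
    joinFiber : {A B C : Type ℓ} (α : El (ΣXY ≃ A)) (β : El (ΣX ≃ B)) (γ : El (ΣY ≃ C)) →
                El (Goal A B C (proj₁ α) (proj₁ β) (proj₁ γ))
    joinFiber {A} {B} {C} α β γ =
      equivInd (λ A α → Goal A B C (proj₁ α) (proj₁ β) (proj₁ γ))
        (equivInd (λ B β → Goal ΣXY B C (λ t → t) (proj₁ β) (proj₁ γ))
          (equivInd (λ C γ → Goal ΣXY ΣX C (λ t → t) (λ x → x) (proj₁ γ)) base γ) β) α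

  -- Fibers of the pushout products of the diagonals

  module Fibers {ℓ} (A B C : Type ℓ) (f : El A → El B) (g : El A → El C) where
    module Rel = RelativeDiagonalPushoutProduct A B C f g

    Kf Kg : Type ℓ
    Kf = KernelPair A B f
    Kg = KernelPair A C g

    Δf : El A → El Kf
    Δf = Δ A B f
    Δg : El A → El Kg
    Δg = Δ A C g

    module Abs = PushoutProduct A Kf A Kg Δf Δg

    Ff Fg : El A → Type ℓ
    Ff x = Σ̇ A λ y → Id B (f x) (f y)
    Fg x = Σ̇ A λ y → Id C (g x) (g y)

    -- The fibers of the two diagonals, as identity types of the fibers of f and g.
    Ωf : El Kf → Type ℓ
    Ωf (x , u) = Id (Ff x) (x , idp) u
    Ωg : El Kg → Type ℓ
    Ωg (x , u) = Id (Fg x) (x , idp) u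

    module RelFiber where
      -- The factors are crossed: the leg from `Kf` hits `(k , s , r)` when s lies on the diagonal
      -- of g, so its factor is `Ωg s`.
      X Y : El Rel.cod → Type ℓ
      X (k , s , r) = Ωg s
      Y (k , s , r) = Ωf k

      module _ (M : (c : El Rel.cod) → El (X c) → Type ℓ) (m : ∀ k → El (M (k , Δg (proj₁ k) , idp) idp)) where
        -- Path induction along x and then r moves s to the diagonal at the source of k. The strict
        -- rule `indX-β` later reduces the coherence of the square to reflexivities.
        indX : ∀ c x → El (M c x)
        indX (k , (y , u) , r) x =
          J (λ u x → M (k , (y , u) , r) x) (J (λ y r → M (k , Δg y , r) idp) (m k) r) x

        indX-β : ∀ k → indX (k , Δg (proj₁ k) , idp) idp ≡ m k
        indX-β k = ≡-trans (J-idp (λ u x → M (k , (proj₁ k , u) , idp) x) _) (J-idp (λ y r → M (k , Δg y , r) idp) (m k))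

      module _ (M : (c : El Rel.cod) → El (Y c) → Type ℓ) (m : ∀ s → El (M (Δf (proj₁ s) , s , idp) idp)) where
        indY : ∀ c y → El (M c y)
        indY ((x , u) , (x′ , v) , r) y =
          J (λ u y → M ((x , u) , (x′ , v) , r) y)
            (J (λ x′ r → Π̇ (Fg x′) λ v → M (Δf x , (x′ , v) , r) idp) (λ v → m (x , v)) r v) y

        indY-β : ∀ s → indY (Δf (proj₁ s) , s , idp) idp ≡ m s
        indY-β (x , v) = ≡-trans (J-idp (λ u y → M ((x , u) , (x , v) , idp) y) _)
          (cong (λ k → k v) (J-idp (λ x′ r → Π̇ (Fg x′) λ v → M (Δf x , (x′ , v) , r) idp) (λ v → m (x , v))))

      module _ (M : (c : El Rel.cod) → El (X c) → El (Y c) → Type ℓ) (m : ∀ x → El (M (Δf x , Δg x , idp) idp idp)) where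
        indXY : ∀ c x y → El (M c x y)
        indXY c@(k , s , r) x y =
          indX (λ (k , s , r) x → Π̇ (Ωf k) λ y → M (k , s , r) x y)
            (λ (z , u) y → J (λ u y → M ((z , u) , Δg z , idp) idp y) (m z) y) c x y

        indXY-β : ∀ x → indXY (Δf x , Δg x , idp) idp idp ≡ m x
        indXY-β x = ≡-trans
          (cong (λ k → k idp) (indX-β (λ (k , s , r) x → Π̇ (Ωf k) λ y → M (k , s , r) x y)
            (λ (z , u) y → J (λ u y → M ((z , u) , Δg z , idp) idp y) (m z) y) (Δf x)))
          (J-idp (λ u y → M ((x , u) , Δg x , idp) idp y) (m x))

      ΣXY ΣX ΣY : Type ℓ
      ΣXY = Σ̇ Rel.cod λ c → X c ×̇ Y c
      ΣX = Σ̇ Rel.cod X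
      ΣY = Σ̇ Rel.cod Y

      equivX : El (ΣX ≃ Kf)
      equivX = mkEquiv (λ (c , x) → proj₁ c) (λ k → (k , Δg (proj₁ k) , idp) , idp)
        (λ (c , x) → indX (λ c x → Id ΣX ((proj₁ c , Δg (proj₁ (proj₁ c)) , idp) , idp) (c , x)) (λ k → idp) c x)
        (λ k → idp)

      equivY : El (ΣY ≃ Kg)
      equivY = mkEquiv (λ (c , y) → proj₁ (proj₂ c)) (λ s → (Δf (proj₁ s) , s , idp) , idp)
        (λ (c , y) → indY (λ (k , s , r) y → Id ΣY ((Δf (proj₁ s) , s , idp) , idp) ((k , s , r) , y)) (λ s → idp) c y)
        (λ s → idp)

      equivXY : El (ΣXY ≃ A)
      equivXY = mkEquiv (λ (c , x , y) → proj₁ (proj₁ c)) (λ z → (Δf z , Δg z , idp) , idp , idp)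
        (λ (c , x , y) → indXY (λ c x y → let z = proj₁ (proj₁ c) in Id ΣXY ((Δf z , Δg z , idp) , idp , idp) (c , x , y))
                           (λ z → idp) c x y)
        (λ z → idp)

      h : El Kf → El Rel.cod
      h k = k , Δg (proj₁ k) , idp
      k : El Kg → El Rel.cod
      k s = Δf (proj₁ s) , s , idp

      Mf Mg : (c : El Rel.cod) → El (X c) → El (Y c) → Type ℓ
      Mf (k , s , r) x y = Id Kf k (Δf (proj₁ k))
      Mg (k , s , r) x y = Id Kg s (Δg (proj₁ k))
      Mh : (c : El Rel.cod) → El (X c) → Type ℓ
      Mh c x = Id Rel.cod c (h (proj₁ c))
      Mk : (c : El Rel.cod) → El (Y c) → Type ℓ
      Mk c y = Id Rel.cod c (k (proj₁ (proj₂ c)))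

      f-path : ∀ c x y → El (Mf c x y)
      f-path = indXY Mf (λ _ → idp)
      g-path : ∀ c x y → El (Mg c x y)
      g-path = indXY Mg (λ _ → idp)
      h-path : ∀ c x → El (Mh c x)
      h-path = indX Mh (λ _ → idp)
      k-path : ∀ c y → El (Mk c y)
      k-path = indY Mk (λ _ → idp)

      fiberJoin : (c : El Rel.cod) → El (fiber Rel.dom Rel.cod Rel.map c ≃ Join (X c) (Y c))
      fiberJoin = joinFiber X Y equivXY equivX equivY Δf Δg h k
        (λ (c , x , y) → f-path c x y) (λ (c , x , y) → g-path c x y) (λ (c , x) → h-path c x) (λ (c , y) → k-path c y)
        (λ _ → idp)
        (λ (c , x , y) → indXY (λ c x y → Id (Id Rel.cod c (k (Δg (proj₁ (proj₁ c)))))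
                                   (h-path c x ∙ ap h (f-path c x y) ∙ idp) (k-path c y ∙ ap k (g-path c x y)))
                           coherence c x y)
        where
          -- At a diagonal point all four homotopies compute strictly to `idp`.
          coherence : ∀ z → let c = Δf z , Δg z , idp in
            El (Id (Id Rel.cod c c) (h-path c idp ∙ ap h (f-path c idp idp) ∙ idp) (k-path c idp ∙ ap k (g-path c idp idp)))
          coherence z
            rewrite indX-β Mh (λ _ → idp) (Δf z) | indY-β Mk (λ _ → idp) (Δg z)
                  | indXY-β Mf (λ _ → idp) z | indXY-β Mg (λ _ → idp) z
                  | ap-idp {A = Kf} {Rel.cod} h {Δf z} | ap-idp {A = Kg} {Rel.cod} k {Δg z}
                  | trans-idp (idp {A = Rel.cod} {Δf z , Δg z , idp}) = ≡⇒≈ (trans-idp idp)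

    module AbsFiber where
      X Y : El Abs.cod → Type ℓ
      X (k , s) = Ωg s
      Y (k , s) = Ωf k

      module _ (M : (c : El Abs.cod) → El (X c) → Type ℓ) (m : ∀ t → El (M (proj₁ t , Δg (proj₂ t)) idp)) where
        indX : ∀ c x → El (M c x)
        indX (k , (y , u)) x = J (λ u x → M (k , (y , u)) x) (m (k , y)) x

        indX-β : ∀ k y → indX (k , Δg y) idp ≡ m (k , y)
        indX-β k y = J-idp (λ u x → M (k , (y , u)) x) (m (k , y))

      module _ (M : (c : El Abs.cod) → El (Y c) → Type ℓ) (m : ∀ t → El (M (Δf (proj₁ t) , proj₂ t) idp)) where
        indY : ∀ c y → El (M c y)
        indY ((x , u) , s) y = J (λ u y → M ((x , u) , s) y) (m (x , s)) y

        indY-β : ∀ x s → indY (Δf x , s) idp ≡ m (x , s)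
        indY-β x s = J-idp (λ u y → M ((x , u) , s) y) (m (x , s))

      module _ (M : (c : El Abs.cod) → El (X c) → El (Y c) → Type ℓ)
               (m : ∀ t → El (M (Δf (proj₁ t) , Δg (proj₂ t)) idp idp)) where
        indXY : ∀ c x y → El (M c x y)
        indXY c x y = indX (λ (k , s) x → Π̇ (Ωf k) λ y → M (k , s) x y)
          (λ ((x , u) , z) y → J (λ u y → M ((x , u) , Δg z) idp y) (m (x , z)) y) c x y

        indXY-β : ∀ x z → indXY (Δf x , Δg z) idp idp ≡ m (x , z)
        indXY-β x z = ≡-trans
          (cong (λ k → k idp) (indX-β (λ (k , s) x → Π̇ (Ωf k) λ y → M (k , s) x y)
            (λ ((x , u) , z) y → J (λ u y → M ((x , u) , Δg z) idp y) (m (x , z)) y) (Δf x) z))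
          (J-idp (λ u y → M ((x , u) , Δg z) idp y) (m (x , z)))

      ΣXY ΣX ΣY : Type ℓ
      ΣXY = Σ̇ Abs.cod λ c → X c ×̇ Y c
      ΣX = Σ̇ Abs.cod X
      ΣY = Σ̇ Abs.cod Y

      equivX : El (ΣX ≃ (Kf ×̇ A))
      equivX = mkEquiv (λ ((k , s) , x) → k , proj₁ s) (λ (k , z) → (k , Δg z) , idp)
        (λ (c , x) → indX (λ c x → Id ΣX ((proj₁ c , Δg (proj₁ (proj₂ c))) , idp) (c , x)) (λ _ → idp) c x)
        (λ _ → idp)

      equivY : El (ΣY ≃ (A ×̇ Kg))
      equivY = mkEquiv (λ ((k , s) , x) → proj₁ k , s) (λ (z , s) → (Δf z , s) , idp)
        (λ (c , y) → indY (λ c y → Id ΣY ((Δf (proj₁ (proj₁ c)) , proj₂ c) , idp) (c , y)) (λ _ → idp) c y)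
        (λ _ → idp)

      equivXY : El (ΣXY ≃ (A ×̇ A))
      equivXY = mkEquiv (λ ((k , s) , x , y) → proj₁ k , proj₁ s) (λ (x , z) → (Δf x , Δg z) , idp , idp)
        (λ (c , x , y) → indXY (λ c x y → Id ΣXY ((Δf (proj₁ (proj₁ c)) , Δg (proj₁ (proj₂ c))) , idp , idp) (c , x , y))
                           (λ _ → idp) c x y)
        (λ _ → idp)

      toB : El (A ×̇ A) → El (Kf ×̇ A)
      toB (x , z) = Δf x , z
      toC : El (A ×̇ A) → El (A ×̇ Kg)
      toC (x , z) = x , Δg z
      h : El (Kf ×̇ A) → El Abs.cod
      h (k , z) = k , Δg z
      k : El (A ×̇ Kg) → El Abs.cod
      k (x , s) = Δf x , s

      Mf Mg : (c : El Abs.cod) → El (X c) → El (Y c) → Type ℓ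
      Mf (k , s) x y = Id (Kf ×̇ A) (k , proj₁ s) (toB (proj₁ k , proj₁ s))
      Mg (k , s) x y = Id (A ×̇ Kg) (proj₁ k , s) (toC (proj₁ k , proj₁ s))
      Mh : (c : El Abs.cod) → El (X c) → Type ℓ
      Mh c x = Id Abs.cod c (h (proj₁ c , proj₁ (proj₂ c)))
      Mk : (c : El Abs.cod) → El (Y c) → Type ℓ
      Mk c y = Id Abs.cod c (k (proj₁ (proj₁ c) , proj₂ c))

      f-path : ∀ c x y → El (Mf c x y)
      f-path = indXY Mf (λ _ → idp)
      g-path : ∀ c x y → El (Mg c x y)
      g-path = indXY Mg (λ _ → idp)
      h-path : ∀ c x → El (Mh c x)
      h-path = indX Mh (λ _ → idp)
      k-path : ∀ c y → El (Mk c y)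
      k-path = indY Mk (λ _ → idp)

      fiberJoin : (c : El Abs.cod) → El (fiber Abs.dom Abs.cod Abs.map c ≃ Join (X c) (Y c))
      fiberJoin = joinFiber X Y equivXY equivX equivY toB toC h k
        (λ (c , x , y) → f-path c x y) (λ (c , x , y) → g-path c x y) (λ (c , x) → h-path c x) (λ (c , y) → k-path c y)
        (λ _ → idp)
        (λ (c , x , y) → indXY (λ c x y → Id (Id Abs.cod c (k (toC (proj₁ (proj₁ c) , proj₁ (proj₂ c)))))
                                   (h-path c x ∙ ap h (f-path c x y) ∙ idp) (k-path c y ∙ ap k (g-path c x y)))
                           (λ (x , z) → coherence x z) c x y)
        where
          coherence : ∀ x z → let c = Δf x , Δg z in
            El (Id (Id Abs.cod c c) (h-path c idp ∙ ap h (f-path c idp idp) ∙ idp) (k-path c idp ∙ ap k (g-path c idp idp)))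
          coherence x z
            rewrite indX-β Mh (λ _ → idp) (Δf x) z | indY-β Mk (λ _ → idp) x (Δg z)
                  | indXY-β Mf (λ _ → idp) x z | indXY-β Mg (λ _ → idp) x z
                  | ap-idp {A = Kf ×̇ A} {Abs.cod} h {Δf x , z} | ap-idp {A = A ×̇ Kg} {Abs.cod} k {x , Δg z}
                  | trans-idp (idp {A = Abs.cod} {Δf x , Δg z}) = ≡⇒≈ (trans-idp idp)

    -- The wedge of kernel pairs formed at the other end of the zigzags, over the second projections.
    module TargetFiber where
      Ff′ Fg′ : El A → Type ℓ
      Ff′ x = Σ̇ A λ y → Id B (f y) (f x)
      Fg′ x = Σ̇ A λ y → Id C (g y) (g x)

      Ωf′ : El Kf → Type ℓ
      Ωf′ (y , x , p) = Id (Ff′ x) (x , idp) (y , p)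
      Ωg′ : El Kg → Type ℓ
      Ωg′ (y , x , p) = Id (Fg′ x) (x , idp) (y , p)

      target : El Kf → El A
      target (y , x , p) = x
      target′ : El Kg → El A
      target′ (y , x , p) = x

      cod : Type ℓ
      cod = Pullback Kf Kg A target target′

      h : El Kf → El cod
      h k = k , Δg (target k) , idp
      k : El Kg → El cod
      k s = Δf (target′ s) , s , idp

      map : El Rel.dom → El cod
      map = Pushout-rec cod h k (λ _ → idp)

      X Y : El cod → Type ℓ
      X (k , s , r) = Ωg′ s
      Y (k , s , r) = Ωf′ k

      module _ (M : (c : El cod) → El (X c) → Type ℓ) (m : ∀ k → El (M (h k) idp)) where
        indX : ∀ c x → El (M c x)
        indX (k , (y , z , p) , r) x =
          J (λ (y , p) x → M (k , (y , z , p) , r) x) (J (λ z r → M (k , Δg z , r) idp) (m k) r) x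

        indX-β : ∀ k → indX (h k) idp ≡ m k
        indX-β k = ≡-trans (J-idp (λ (y , p) x → M (k , (y , target k , p) , idp) x) _)
                           (J-idp (λ z r → M (k , Δg z , r) idp) (m k))

      module _ (M : (c : El cod) → El (Y c) → Type ℓ) (m : ∀ s → El (M (k s) idp)) where
        indY : ∀ c y → El (M c y)
        indY ((w , x , u) , (y , z , p) , r) q =
          J (λ (w , u) q → M ((w , x , u) , (y , z , p) , r) q)
            (J (λ z r → Π̇ (Fg′ z) λ v → M (Δf x , (proj₁ v , z , proj₂ v) , r) idp)
               (λ v → m (proj₁ v , x , proj₂ v)) r (y , p)) q

        indY-β : ∀ s → indY (k s) idp ≡ m s
        indY-β (y , x , p) = ≡-trans (J-idp (λ (w , u) q → M ((w , x , u) , (y , x , p) , idp) q) _)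
          (cong (λ k → k (y , p)) (J-idp (λ z r → Π̇ (Fg′ z) λ v → M (Δf x , (proj₁ v , z , proj₂ v) , r) idp)
                                         (λ v → m (proj₁ v , x , proj₂ v))))

      module _ (M : (c : El cod) → El (X c) → El (Y c) → Type ℓ) (m : ∀ x → El (M (Δf x , Δg x , idp) idp idp)) where
        private
          onΔg : (k : El Kf) (y : El (Ωf′ k)) → El (M (h k) idp y)
          onΔg (w , x , u) y = J (λ (w , u) y → M ((w , x , u) , Δg x , idp) idp y) (m x) y

        indXY : ∀ c x y → El (M c x y)
        indXY c x y = indX (λ (k , s , r) x → Π̇ (Ωf′ k) λ y → M (k , s , r) x y) onΔg c x y

        indXY-β : ∀ x → indXY (Δf x , Δg x , idp) idp idp ≡ m x
        indXY-β x = ≡-trans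
          (cong (λ k → k idp) (indX-β (λ (k , s , r) x → Π̇ (Ωf′ k) λ y → M (k , s , r) x y) onΔg (Δf x)))
          (J-idp (λ (w , u) y → M ((w , x , u) , Δg x , idp) idp y) (m x))

      ΣXY ΣX ΣY : Type ℓ
      ΣXY = Σ̇ cod λ c → X c ×̇ Y c
      ΣX = Σ̇ cod X
      ΣY = Σ̇ cod Y

      equivX : El (ΣX ≃ Kf)
      equivX = mkEquiv (λ (c , x) → proj₁ c) (λ k → h k , idp)
        (λ (c , x) → indX (λ c x → Id ΣX (h (proj₁ c) , idp) (c , x)) (λ _ → idp) c x)
        (λ _ → idp)

      equivY : El (ΣY ≃ Kg)
      equivY = mkEquiv (λ (c , y) → proj₁ (proj₂ c)) (λ s → k s , idp)
        (λ (c , y) → indY (λ c y → Id ΣY (k (proj₁ (proj₂ c)) , idp) (c , y)) (λ _ → idp) c y)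
        (λ _ → idp)

      equivXY : El (ΣXY ≃ A)
      equivXY = mkEquiv (λ (c , x , y) → target (proj₁ c)) (λ z → (Δf z , Δg z , idp) , idp , idp)
        (λ (c , x , y) → indXY (λ c x y → let z = target (proj₁ c) in Id ΣXY ((Δf z , Δg z , idp) , idp , idp) (c , x , y))
                           (λ _ → idp) c x y)
        (λ _ → idp)

      Mf Mg : (c : El cod) → El (X c) → El (Y c) → Type ℓ
      Mf (k , s , r) x y = Id Kf k (Δf (target k))
      Mg (k , s , r) x y = Id Kg s (Δg (target k))
      Mh : (c : El cod) → El (X c) → Type ℓ
      Mh c x = Id cod c (h (proj₁ c))
      Mk : (c : El cod) → El (Y c) → Type ℓ
      Mk c y = Id cod c (k (proj₁ (proj₂ c)))

      f-path : ∀ c x y → El (Mf c x y)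
      f-path = indXY Mf (λ _ → idp)
      g-path : ∀ c x y → El (Mg c x y)
      g-path = indXY Mg (λ _ → idp)
      h-path : ∀ c x → El (Mh c x)
      h-path = indX Mh (λ _ → idp)
      k-path : ∀ c y → El (Mk c y)
      k-path = indY Mk (λ _ → idp)

      fiberJoin : (c : El cod) → El (fiber Rel.dom cod map c ≃ Join (X c) (Y c))
      fiberJoin = joinFiber X Y equivXY equivX equivY Δf Δg h k
        (λ (c , x , y) → f-path c x y) (λ (c , x , y) → g-path c x y) (λ (c , x) → h-path c x) (λ (c , y) → k-path c y)
        (λ _ → idp)
        (λ (c , x , y) → indXY (λ c x y → Id (Id cod c (k (Δg (target (proj₁ c)))))
                                   (h-path c x ∙ ap h (f-path c x y) ∙ idp) (k-path c y ∙ ap k (g-path c x y)))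
                           coherence c x y)
        where
          coherence : ∀ z → let c = Δf z , Δg z , idp in
            El (Id (Id cod c c) (h-path c idp ∙ ap h (f-path c idp idp) ∙ idp) (k-path c idp ∙ ap k (g-path c idp idp)))
          coherence z
            rewrite indX-β Mh (λ _ → idp) (Δf z) | indY-β Mk (λ _ → idp) (Δg z)
                  | indXY-β Mf (λ _ → idp) z | indXY-β Mg (λ _ → idp) z
                  | ap-idp {A = Kf} {cod} h {Δf z} | ap-idp {A = Kg} {cod} k {Δg z}
                  | trans-idp (idp {A = cod} {Δf z , Δg z , idp}) = ≡⇒≈ (trans-idp idp)

  -- From acyclic maps to contractible joins

  isAcyclic-equiv : {T T′ : Type ℓ} → El (T ≃ T′) → El (isAcyclic T) → El (isAcyclic T′)
  isAcyclic-equiv {T = T} = equivInd (λ T′ _ → isAcyclic T ⇒ isAcyclic T′) (λ h → h)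

  contractible⇒acyclic : (T : Type ℓ) → El (isContr T) → El (isAcyclic T)
  contractible⇒acyclic T (t , h) = inl tt , Pushout-elim (λ w → Id (Susp T) (inl tt) w) (λ _ → idp) (λ _ → glue t)
    (λ t′ → transport-Id-const (λ w → w) (glue t′)
      (idp-trans (ap (λ w → w) (glue t′)) ∙ ap-id (glue t′) ∙ ap glue (sym (h t′))))

  Id-equiv : {B B′ : Type ℓ} (e : El (B ≃ B′)) (u v : El B) → El (Id B u v ≃ Id B′ (proj₁ e u) (proj₁ e v))
  Id-equiv {B = B} = equivInd (λ B′ e → Π̇ B λ u → Π̇ B λ v → Id B u v ≃ Id B′ (proj₁ e u) (proj₁ e v))
    (λ u v → idEquiv (Id B u v))

  Join-isContr-equiv : {X Y X′ Y′ : Type ℓ} → El (X ≃ X′) → El (Y ≃ Y′) → El (isContr (Join X Y)) → El (isContr (Join X′ Y′))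
  Join-isContr-equiv {X = X} {Y} {X′} {Y′} e e′ h =
    equivInd (λ X′ _ → isContr (Join X′ Y′)) (equivInd (λ Y′ _ → isContr (Join X Y′)) h e′) e

  symΣ-equiv : (A B : Type ℓ) (f : El A → El B) (y : El B) →
               El ((Σ̇ A λ x → Id B y (f x)) ≃ (Σ̇ A λ x → Id B (f x) y))
  symΣ-equiv A B f y = mkEquiv (λ (x , p) → x , sym p) (λ (x , p) → x , sym p)
    (λ (x , p) → ap (λ p → x , p) (sym-sym p)) (λ (x , p) → ap (λ p → x , p) (sym-sym p))

  module Connectivity {ℓ} (A B C : Type ℓ) (f : El A → El B) (g : El A → El C) where
    open Fibers A B C f g public

    JoinsContractible : Type ℓ
    JoinsContractible = Π̇ Rel.cod λ (k , s , r) → isContr (Join (Ωg s) (Ωf k))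

    rel-contractible⇒joins : El (isContrMap Rel.dom Rel.cod Rel.map) → El JoinsContractible
    rel-contractible⇒joins h c = isContr-equiv _ _ (symEquiv (RelFiber.fiberJoin c)) (h c)

    joins⇒rel-contractible : El JoinsContractible → El (isContrMap Rel.dom Rel.cod Rel.map)
    joins⇒rel-contractible h c = isContr-equiv _ _ (RelFiber.fiberJoin c) (h c)

    acyclicJoin⇒contractibleJoin : El (PlusPrinciple ℓ) → (k : El Kf) (s : El Kg) →
                                   El (isAcyclic (Join (Ωg s) (Ωf k))) → El (isContr (Join (Ωg s) (Ωf k)))
    acyclicJoin⇒contractibleJoin plus (x , u) (y , v) = acyclicJoin⇒contractible plus _ _
      (isHomogeneous-Id (Fg y) (y , idp) v) (isHomogeneous-Id (Ff x) (x , idp) u)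

    rel-acyclic⇒joins : El (PlusPrinciple ℓ) → El (isAcyclicMap Rel.dom Rel.cod Rel.map) → El JoinsContractible
    rel-acyclic⇒joins plus h c@(k , s , r) =
      acyclicJoin⇒contractibleJoin plus k s (isAcyclic-equiv (RelFiber.fiberJoin c) (h c))

    -- The fiber of the relative map over `(k , s , r)` is the same join as that of the absolute map
    -- over `(k , s)`: the path r does not enter.
    abs-acyclic⇒joins : El (PlusPrinciple ℓ) → El (isAcyclicMap Abs.dom Abs.cod Abs.map) → El JoinsContractible
    abs-acyclic⇒joins plus h (k , s , r) =
      acyclicJoin⇒contractibleJoin plus k s (isAcyclic-equiv (AbsFiber.fiberJoin (k , s)) (h (k , s)))

    private
      open TargetFiber

      Ωf-reverse : (k : El Kf) → let (y , x , p) = k in El (Ωf (x , y , sym p) ≃ Ωf′ k)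
      Ωf-reverse (y , x , p) = compEquiv (Id-equiv (symΣ-equiv A B f (f x)) (x , idp) (y , sym p))
        (coerce (sym-idp) (sym-sym p))
        where
          coerce : ∀ {q q′} → q ≡ idp → El (q′ ≈ p) → El (Id (Ff′ x) (x , q) (y , q′) ≃ Ωf′ (y , x , p))
          coerce refl = J (λ p _ → Id (Ff′ x) (x , idp) (y , _) ≃ Id (Ff′ x) (x , idp) (y , p)) (idEquiv _)

      Ωg-reverse : (k : El Kg) → let (y , x , p) = k in El (Ωg (x , y , sym p) ≃ Ωg′ k)
      Ωg-reverse (y , x , p) = compEquiv (Id-equiv (symΣ-equiv A C g (g x)) (x , idp) (y , sym p))
        (coerce (sym-idp) (sym-sym p))
        where
          coerce : ∀ {q q′} → q ≡ idp → El (q′ ≈ p) → El (Id (Fg′ x) (x , q) (y , q′) ≃ Ωg′ (y , x , p))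
          coerce refl = J (λ p _ → Id (Fg′ x) (x , idp) (y , _) ≃ Id (Fg′ x) (x , idp) (y , p)) (idEquiv _)

    -- Reversing both paths turns kernel-pair elements with a common target into ones with a common
    -- source, without changing the two factors of the join up to equivalence.
    joins⇒target-contractible : El JoinsContractible → El (isContrMap Rel.dom cod map)
    joins⇒target-contractible h c@(k@(w , x , p) , s@(y , z , q) , r) =
      isContr-equiv _ _ (TargetFiber.fiberJoin c)
        (Join-isContr-equiv (Ωg-reverse s) (Ωf-reverse k) (h ((x , w , sym p) , (z , y , sym q) , r)))

  J⁻ : {A : Type a} {y : El A} (Q : (x : El A) → El (Id A x y) → Type b) → El (Q y idp) →
       ∀ {x} (p : El (Id A x y)) → El (Q x p)
  J⁻ {A = A} {y} Q d {x} p = transport (Q x) (sym-sym p)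
    (J (λ x r → Q x (sym r)) (subst (λ r → El (Q y r)) (≡-sym sym-idp) d) (sym p))

  Σ-equiv : (A : Type a) (B : El A → Type b) (B′ : El A → Type c) → ((x : El A) → El (B x ≃ B′ x)) →
            El (Σ̇ A B ≃ Σ̇ A B′)
  Σ-equiv A B B′ e = mkEquiv (λ (x , u) → x , proj₁ (e x) u) (λ (x , v) → x , inverse (e x) v)
    (λ (x , u) → ap (λ u → x , u) (inverse-left (e x) u)) (λ (x , v) → ap (λ v → x , v) (inverse-right (e x) v))

  -- Based path induction for pushouts, in the style of Kraus and von Raumer: a family over the based
  -- paths of a pushout amounts to two families and equivalences over glue.

  module BasedFamilies {ℓ} (P : Type ℓ) (p₀ : El P) where
    Fam : El P → Type (lsuc ℓ)
    Fam w = Id P p₀ w ⇒ 𝒰 ℓ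

    Pointwise : ∀ {w w′} (p : El (Id P w w′)) (u : El (Fam w)) (v : El (Fam w′)) → Type (lsuc ℓ)
    Pointwise {w} p u v = Π̇ (Id P p₀ w) λ q → Id (𝒰 ℓ) (u q) (v (q ∙ p))

    relabel : ∀ {w} (u v : El (Fam w)) → (∀ q → El (Id (𝒰 ℓ) (u q) (v q))) → El (Pointwise idp u v)
    relabel u v h q = subst (λ z → El (Id (𝒰 ℓ) (u q) (v z))) (≡-sym (trans-idp q)) (h q)

    relabel⁻¹ : ∀ {w} (u v : El (Fam w)) → El (Pointwise idp u v) → ∀ q → El (Id (𝒰 ℓ) (u q) (v q))
    relabel⁻¹ u v h q = subst (λ z → El (Id (𝒰 ℓ) (u q) (v z))) (trans-idp q) (h q)

    pointwise-base : ∀ {w} {t : El (Fam w)} (u : El (Fam w)) → t ≡ u → (v : El (Fam w)) → El (Id (Fam w) t v) →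
                     El (Pointwise idp u v)
    pointwise-base {w} u e v r = relabel u v (happly (subst (λ t → El (Id (Fam w) t v)) e r))

    pointwise-base-isEquiv : ∀ {w} {t : El (Fam w)} (u : El (Fam w)) (e : t ≡ u) (v : El (Fam w)) →
                             El (isEquiv (Id (Fam w) t v) (Pointwise idp u v) (pointwise-base u e v))
    pointwise-base-isEquiv {w} u refl v = quasiInverse⇒isEquiv (pointwise-base u refl v)
      (λ h → funext L (λ _ → 𝒰 ℓ) (relabel⁻¹ u v h))
      (λ r → ap {A = Pt} (funext L (λ _ → 𝒰 ℓ))
               (funext L (λ q → Id (𝒰 ℓ) (u q) (v q)) λ q → ≡⇒≈ (subst-subst-sym (trans-idp q)))
             ∙ funext-happly (λ _ → 𝒰 ℓ) r)
      (λ h → ap {A = Pt} (relabel u v) (happly-funext (λ _ → 𝒰 ℓ) (relabel⁻¹ u v h))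
             ∙ funext L (λ q → Id (𝒰 ℓ) (u q) (v (q ∙ idp))) λ q → ≡⇒≈ (subst-sym-subst (trans-idp q)))
      where
        L : Type ℓ
        L = Id P p₀ w
        Pt : Type (lsuc ℓ)
        Pt = Π̇ L λ q → Id (𝒰 ℓ) (u q) (v q)

    module _ {w} (u : El (Fam w)) where
      Motive : ∀ w′ → El (Id P w w′) → Type (lsuc ℓ)
      Motive w′ p = Π̇ (Fam w′) λ v → Id (Fam w′) (transport Fam p u) v ⇒ Pointwise p u v

      baseMap : El (Motive w idp)
      baseMap v = pointwise-base u (transport-idp {A = P} Fam u) v

      pointwise : ∀ {w′} (p : El (Id P w w′)) → El (Motive w′ p)
      pointwise p = J Motive baseMap p

      pointwise-isEquiv : ∀ {w′} (p : El (Id P w w′)) (v : El (Fam w′)) →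
                          El (isEquiv (Id (Fam w′) (transport Fam p u) v) (Pointwise p u v) (pointwise p v))
      pointwise-isEquiv p =
        J (λ w′ p → Π̇ (Fam w′) λ v → isEquiv (Id (Fam w′) (transport Fam p u) v) (Pointwise p u v) (pointwise p v))
          (λ v → subst (λ k → El (isEquiv (Id (Fam w) (transport {A = P} Fam idp u) v) (Pointwise idp u v) (k v)))
                   (≡-sym (J-idp Motive baseMap)) (pointwise-base-isEquiv u (transport-idp {A = P} Fam u) v))
          p

    -- The identification that `M` induces along p carries the value of a section at q to its value
    -- at q ∙ p; this makes sections computable over `glue`.
    pointwise-section : (M : ∀ w → El (Fam w)) (s : ∀ w q → El (M w q)) → ∀ {w w′} (p : El (Id P w w′)) q →
                        El (Id (M w′ (q ∙ p)) (coe (pointwise (M w) p (M w′) (apd Fam M p) q) (s w q)) (s w′ (q ∙ p)))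
    pointwise-section M s {w} p q =
      J (λ w′ p → Id (M w′ (q ∙ p)) (coe (pointwise (M w) p (M w′) (apd Fam M p) q) (s w q)) (s w′ (q ∙ p))) base p
      where
        strip : ∀ {t} (e : t ≡ M w) →
          El (Id (M w (q ∙ idp)) (coe (pointwise-base (M w) e (M w) (strict⇒Id (Fam w) e) q) (s w q)) (s w (q ∙ idp)))
        strip refl rewrite ap-idp {A = Fam w} {𝒰 ℓ} (λ k → k q) {M w} = strip′ (trans-idp q)
          where
            strip′ : ∀ {q′} (e : q′ ≡ q) →
              El (Id (M w q′) (coe (subst (λ z → El (Id (𝒰 ℓ) (M w q) (M w z))) (≡-sym e) idp) (s w q)) (s w q′))
            strip′ refl = strict⇒Id (M w q) (cong (λ e → proj₁ e (s w q)) (idToEquiv-idp (M w q)))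
        base : El (Id (M w (q ∙ idp)) (coe (pointwise (M w) idp (M w) (apd {A = P} Fam M idp) q) (s w q)) (s w (q ∙ idp)))
        base = subst₂ (λ k r → El (Id (M w (q ∙ idp)) (coe (k (M w) r q) (s w q)) (s w (q ∙ idp))))
          (≡-sym (J-idp (Motive (M w)) (baseMap (M w))))
          (≡-sym (J-idp (λ w′ p → Id (Fam w′) (transport Fam p (M w)) (M w′)) (strict⇒Id (Fam w) (transport-idp {A = P} Fam (M w)))))
          (strip (transport-idp {A = P} Fam (M w)))

  module PushoutPathInduction {ℓ} (A B C : Type ℓ) (f : El A → El B) (g : El A → El C) (b₀ : El B) where
    private
      P : Type ℓ
      P = Pushout A B C f g

    open BasedFamilies P (inl b₀)

    module _ (Mₗ : (b : El B) → El (Id P (inl b₀) (inl b)) → Type ℓ)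
             (Mᵣ : (c : El C) → El (Id P (inl b₀) (inr c)) → Type ℓ)
             (e : ∀ x q → El (Mₗ (f x) q ≃ Mᵣ (g x) (q ∙ glue x))) (m : El (Mₗ b₀ idp)) where
      private
        Φ : ∀ x → El (Id (Fam (inr (g x))) (transport Fam (glue x) (Mₗ (f x))) (Mᵣ (g x))
                     ≃ Pointwise (glue x) (Mₗ (f x)) (Mᵣ (g x)))
        Φ x = pointwise (Mₗ (f x)) (glue x) (Mᵣ (g x)) , pointwise-isEquiv (Mₗ (f x)) (glue x) (Mᵣ (g x))

        M-glue : ∀ x → El (Id (Fam (inr (g x))) (transport Fam (glue x) (Mₗ (f x))) (Mᵣ (g x)))
        M-glue x = inverse (Φ x) (λ q → ua (e x q))

        M : ∀ w → El (Fam w)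
        M = Pushout-elim Fam Mₗ Mᵣ M-glue

        M-inl : ∀ b → M (inl b) ≡ Mₗ b
        M-inl = Pushout-elim-inl Fam Mₗ Mᵣ M-glue
        M-inr : ∀ c → M (inr c) ≡ Mᵣ c
        M-inr = Pushout-elim-inr Fam Mₗ Mᵣ M-glue

        m′ : El (M (inl b₀) idp)
        m′ = subst (λ k → El (k idp)) (≡-sym (M-inl b₀)) m

        section : ∀ w q → El (M w q)
        section w q = J M m′ q

      opaque
        sectionₗ : ∀ b q → El (Mₗ b q)
        sectionₗ b q = subst (λ k → El (k q)) (M-inl b) (section (inl b) q)

        sectionᵣ : ∀ c q → El (Mᵣ c q)
        sectionᵣ c q = subst (λ k → El (k q)) (M-inr c) (section (inr c) q)

        sectionₗ-idp : sectionₗ b₀ idp ≡ m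
        sectionₗ-idp = ≡-trans (cong (subst (λ k → El (k idp)) (M-inl b₀)) (J-idp M m′)) (subst-subst-sym (M-inl b₀))

        -- The rule holds up to a path, because it combines the rule for `glue`, the inverse of `Φ`
        -- and `coe-ua`. It is the only access to values of `sectionᵣ`.
        sectionᵣ-glue : ∀ x q → El (Id (Mᵣ (g x) (q ∙ glue x)) (sectionᵣ (g x) (q ∙ glue x)) (proj₁ (e x q) (sectionₗ (f x) q)))
        sectionᵣ-glue x q = strip (M-inl (f x)) (M-inr (g x)) (apd Fam M (glue x))
          (Pushout-elim-glue Fam Mₗ Mᵣ M-glue x) _ _ (pointwise-section M section (glue x) q)
          where
            strip : ∀ {u v} (i : u ≡ Mₗ (f x)) (j : v ≡ Mᵣ (g x))
              (r : El (Id (Fam (inr (g x))) (transport Fam (glue x) u) v)) →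
              El (Id (Id (Fam (inr (g x))) (transport Fam (glue x) (Mₗ (f x))) (Mᵣ (g x)))
                   (subst₂ (λ u v → El (Id (Fam (inr (g x))) (transport Fam (glue x) u) v)) i j r) (M-glue x)) →
              (y : El (u q)) (z : El (v (q ∙ glue x))) →
              El (Id (v (q ∙ glue x)) (coe (pointwise u (glue x) v r q) y) z) →
              El (Id (Mᵣ (g x) (q ∙ glue x)) (subst (λ k → El (k (q ∙ glue x))) j z)
                   (proj₁ (e x q) (subst (λ k → El (k q)) i y)))
            strip refl refl r β y z h = sym h
              ∙ ap (λ p → coe p y)
                   (ap (λ r → proj₁ (Φ x) r q) β
                    ∙ happly {B = λ q → Id (𝒰 ℓ) (Mₗ (f x) q) (Mᵣ (g x) (q ∙ glue x))}
                             (inverse-right (Φ x) (λ q → ua (e x q))) q)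
              ∙ coe-ua (e x q) y

  -- Comparing two families with the same total space

  module _ (U : Type a) (D : Type b) (N N′ : El D → Type c) (τ : El (U ≃ Σ̇ D N)) (τ′ : El (U ≃ Σ̇ D N′))
           (h : ∀ u → El (Id D (proj₁ (proj₁ τ u)) (proj₁ (proj₁ τ′ u)))) where
    private
      base base′ : El U → El D
      base u = proj₁ (proj₁ τ u)
      base′ u = proj₁ (proj₁ τ′ u)
      point : ∀ u → El (N (base u))
      point u = proj₂ (proj₁ τ u)
      point′ : ∀ u → El (N′ (base′ u))
      point′ u = proj₂ (proj₁ τ′ u)
      fibers : ∀ d → El (fiber U D base d ≃ N d)
      fibers = fiberEquiv U D N base point (proj₂ τ)
      fibers′ : ∀ d → El (fiber U D base′ d ≃ N′ d)
      fibers′ = fiberEquiv U D N′ base′ point′ (proj₂ τ′)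

    opaque
      -- Both `N d` and `N′ d` are fibers of U over d, for homotopic projections.
      fiberwiseEquiv : ∀ d → El (N d ≃ N′ d)
      fiberwiseEquiv d = compEquiv (symEquiv (fibers d)) (compEquiv (proj₁ (fiber-homotopic U D base h d)) (fibers′ d))

      fiberwiseEquiv-point : ∀ u → El (Id (N′ (base u)) (proj₁ (fiberwiseEquiv (base u)) (point u))
                                          (transport N′ (sym (h u) ∙ idp) (point′ u)))
      fiberwiseEquiv-point u =
        ap {A = fiber U D base (base u)} (λ z → proj₁ (fibers′ (base u)) (proj₁ (proj₁ (fiber-homotopic U D base h (base u))) z))
           start
        ∙ ap {A = fiber U D base′ (base u)} (proj₁ (fibers′ (base u))) (proj₂ (fiber-homotopic U D base h (base u)) (u , idp))
        where
          start : El (Id (fiber U D base (base u)) (inverse (fibers (base u)) (point u)) (u , idp))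
          start = strict⇒Id (fiber U D base (base u))
                    (cong (inverse (fibers (base u))) (≡-sym (transport-idp {A = D} N (point u))))
                  ∙ inverse-left (fibers (base u)) (u , idp)

  -- A zigzag of three paths one of which is degenerate can be simplified; zigzag-agree is the coherence
  -- between the two simplifications that apply when all three paths coincide.
  module _ {P : Type a} where
    private
      Cancelˡ : {x y x′ y′ : El P} → El (Id P x y) → El (Id P x x′) → El (Id P x′ y′) → Type a
      Cancelˡ l t l′ = l ∙ sym idp ∙ sym l ∙ t ∙ l′ ≈ t ∙ l′ ∙ sym idp

      Cancelʳ : {x y x″ y″ : El P} → El (Id P x″ y″) → El (Id P y y″) → El (Id P x y) → Type a
      Cancelʳ l″ s l = l″ ∙ sym s ∙ sym l ∙ idp ∙ l ≈ idp ∙ l″ ∙ sym s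

      refls : {x : El P} → idp {A = P} {x} ∙ sym idp ∙ sym idp ∙ idp ∙ idp ≡ idp ∙ idp ∙ sym idp
      refls {x} rewrite sym-idp {A = P} {x} | trans-idp (idp {A = P} {x}) | trans-idp (idp {A = P} {x})
                      | trans-idp (idp {A = P} {x}) | trans-idp (idp {A = P} {x}) = refl

      refls-≈ : (x : El P) → El (idp {A = P} {x} ∙ sym idp ∙ sym idp ∙ idp ∙ idp ≈ idp ∙ idp ∙ sym idp)
      refls-≈ x = ≡⇒≈ refls

      cancelˡ : {x y x′ y′ : El P} (l : El (Id P x y)) (t : El (Id P x x′)) (l′ : El (Id P x′ y′)) → El (Cancelˡ l t l′)
      cancelˡ {x} l t l′ = J (λ _ l′ → Cancelˡ l t l′)
        (J (λ _ t → Cancelˡ l t idp) (J (λ _ l → Cancelˡ l idp idp) (refls-≈ x) l) t) l′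

      cancelʳ : {x y x″ y″ : El P} (l″ : El (Id P x″ y″)) (s : El (Id P y y″)) (l : El (Id P x y)) → El (Cancelʳ l″ s l)
      cancelʳ {x} {y} l″ s l = J (λ y″ l″ → Π̇ (Id P y y″) λ s → Cancelʳ l″ s l)
        (λ s → J (λ _ s → Cancelʳ idp s l) (J (λ _ l → Cancelʳ idp idp l) (refls-≈ x) l) s) l″ s

      cancelˡ-idp : {x : El P} → cancelˡ (idp {A = P} {x}) idp idp ≡ refls-≈ x
      cancelˡ-idp {x} = ≡-trans (J-idp (λ _ l′ → Cancelˡ idp idp l′) _)
        (≡-trans (J-idp (λ _ t → Cancelˡ idp t idp) _) (J-idp (λ _ l → Cancelˡ l idp idp) (refls-≈ x)))

      cancelʳ-idp : {x : El P} → cancelʳ (idp {A = P} {x}) idp idp ≡ refls-≈ x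
      cancelʳ-idp {x} = ≡-trans (cong (λ k → k idp) (J-idp (λ y″ l″ → Π̇ (Id P x y″) λ s → Cancelʳ l″ s idp) _))
        (≡-trans (J-idp (λ _ s → Cancelʳ idp s idp) _) (J-idp (λ _ l → Cancelʳ idp idp l) (refls-≈ x)))

    zigzagˡ : {x y x′ y′ : El P} (l : El (Id P x y)) (t : El (Id P x x′)) (l′ : El (Id P x′ y′))
              {i : El (Id P y y)} {j : El (Id P y′ y′)} → i ≡ idp → j ≡ idp →
              El (l ∙ sym i ∙ sym l ∙ t ∙ l′ ≈ t ∙ l′ ∙ sym j)
    zigzagˡ l t l′ refl refl = cancelˡ l t l′

    zigzagʳ : {x y x″ y″ : El P} (l″ : El (Id P x″ y″)) {s s′ : El (Id P y y″)} (l : El (Id P x y))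
              {i : El (Id P x x)} {j : El (Id P x″ x″)} → s ≡ s′ → i ≡ idp → j ≡ idp →
              El (l″ ∙ sym s ∙ sym l ∙ i ∙ l ≈ j ∙ l″ ∙ sym s′)
    zigzagʳ l″ {s} l refl refl refl = cancelʳ l″ s l

    zigzag-agree : {x y : El P} (l : El (Id P x y)) {t : El (Id P x x)} {i j : El (Id P y y)}
                   (t-idp : t ≡ idp) (i-idp : i ≡ idp) (j-idp : j ≡ idp) (i≡j : i ≡ j) →
                   El (zigzagˡ l t l i-idp j-idp ≈ zigzagʳ l l i≡j t-idp t-idp)
    zigzag-agree {x} l refl refl refl refl =
      J (λ y l → Id (Cancelˡ l idp l) (cancelˡ l idp l) (cancelʳ l idp l)) base l
      where
        base : El (Id (Cancelˡ idp idp idp) (cancelˡ (idp {A = P} {x}) idp idp) (cancelʳ (idp {A = P} {x}) idp idp))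
        base rewrite cancelˡ-idp {x} | cancelʳ-idp {x} = idp

  -- The Blakers-Massey argument

  module BlakersMassey {ℓ} (A B C : Type ℓ) (f : El A → El B) (g : El A → El C) where
    open Connectivity A B C f g
    module Tgt = TargetFiber

    P : Type ℓ
    P = Pushout A B C f g

    apl : {x y : El B} → El (Id B x y) → El (Id P (inl x) (inl y))
    apl = ap inl
    apr : {x y : El C} → El (Id C x y) → El (Id P (inr x) (inr y))
    apr = ap inr

    gl : (x : El A) → El (Id P (inl (f x)) (inr (g x)))
    gl = glue

    -- R x b and Q b c are the spans f x — b of length two and b — c of length one in the relation
    -- that f and g define between B and C; ψ and φ send them to paths in the pushout.
    R : El A → El B → Type ℓ
    R x b = Σ̇ A λ y → Id B (f y) b ×̇ Id C (g y) (g x)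

    ψ : (x : El A) {b : El B} → El (R x b) → El (Id P (inl (f x)) (inl b))
    ψ x (y , p , q) = gl x ∙ sym (apr q) ∙ sym (gl y) ∙ apl p

    Q : El B → El C → Type ℓ
    Q b c = Σ̇ A λ y → Id B b (f y) ×̇ Id C c (g y)

    φ : {b : El B} {c : El C} → El (Q b c) → El (Id P (inl b) (inr c))
    φ (y , p , q) = apl p ∙ gl y ∙ sym (apr q)

    Tot : Type ℓ
    Tot = Σ̇ A λ x → Σ̇ A λ z → Id P (inl (f x)) (inr (g z))

    -- Two kinds of zigzag from f x to g z with composite ρ: three edges, the last of which is z,
    -- and a single edge.
    N₁ N₂ : El Tot → Type ℓ
    N₁ (x , z , ρ) = Σ̇ (R x (f z)) λ n → Id (Id P (inl (f x)) (inr (g z))) (ψ x n ∙ gl z) ρ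
    N₂ (x , z , ρ) = fiber (Q (f x) (g z)) (Id P (inl (f x)) (inr (g z))) φ ρ

    moveˡ : {x y z : El A} → El (Id A x y) → El (Id C (g y) (g z)) → El (Id C (g x) (g z))
    moveˡ {z = z} r = transport (λ x → Id C (g x) (g z)) (sym r)

    moveˡ-idp : {x z : El A} (q : El (Id C (g x) (g z))) → moveˡ idp q ≡ q
    moveˡ-idp {x} {z} q rewrite sym-idp {A = A} {x} = transport-idp {A = A} (λ x → Id C (g x) (g z)) q

    moveʳ : {x y z : El A} → El (Id A x y) → El (Id C (g z) (g y)) → El (Id C (g z) (g x))
    moveʳ {z = z} r = transport (λ x → Id C (g z) (g x)) (sym r)

    moveʳ-idp : {x z : El A} (q : El (Id C (g z) (g x))) → moveʳ idp q ≡ q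
    moveʳ-idp {x} {z} q rewrite sym-idp {A = A} {x} = transport-idp {A = A} (λ x → Id C (g z) (g x)) q

    toN₁ : El Rel.cod → El (Σ̇ Tot N₁)
    toN₁ ((x , z , p) , (x′ , w , q) , r) = let n = x , p , moveˡ r q in (w , z , ψ w n ∙ gl z) , n , idp

    toN₂ : El Tgt.cod → El (Σ̇ Tot N₂)
    toN₂ ((w , x , p) , (z , x′ , q) , r) = let n = x , p , moveʳ r q in (w , z , φ n) , n , idp

    -- The common source x is the middle edge of a zigzag w, x, z; w and x meet in C, x and z in B.
    -- The composite ρ with its witness is a singleton.
    κ₁ : El (Rel.cod ≃ Σ̇ Tot N₁)
    κ₁ = mkEquiv toN₁ (λ ((w , z , ρ) , (x , p , q) , _) → (x , z , p) , (x , w , q) , idp)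
      (λ ((x , z , p) , (x′ , w , q) , r) →
        J (λ x′ r → Π̇ (Id C (g x′) (g w)) λ q →
             Id Rel.cod ((x , z , p) , (x , w , moveˡ r q) , idp) ((x , z , p) , (x′ , w , q) , r))
          (λ q → strict⇒Id Rel.cod (cong (λ q → (x , z , p) , (x , w , q) , idp) (moveˡ-idp q))) r q)
      (λ ((w , z , ρ) , (x , p , q) , e) →
        J (λ ρ e → Id (Σ̇ Tot N₁) (toN₁ ((x , z , p) , (x , w , q) , idp)) ((w , z , ρ) , (x , p , q) , e))
          (strict⇒Id (Σ̇ Tot N₁) (cong (λ q → (w , z , ψ w (x , p , q) ∙ gl z) , (x , p , q) , idp) (moveˡ-idp q))) e)

    -- The common target is the single edge; w and z only present its end points as f w and g z.
    κ₂ : El (Tgt.cod ≃ Σ̇ Tot N₂)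
    κ₂ = mkEquiv toN₂ (λ ((w , z , ρ) , (x , p , q) , _) → (w , x , p) , (z , x , q) , idp)
      (λ ((w , x , p) , (z , x′ , q) , r) →
        J (λ x′ r → Π̇ (Id C (g z) (g x′)) λ q →
             Id Tgt.cod ((w , x , p) , (z , x , moveʳ r q) , idp) ((w , x , p) , (z , x′ , q) , r))
          (λ q → strict⇒Id Tgt.cod (cong (λ q → (w , x , p) , (z , x , q) , idp) (moveʳ-idp q))) r q)
      (λ ((w , z , ρ) , (x , p , q) , e) →
        J (λ ρ e → Id (Σ̇ Tot N₂) (toN₂ ((w , x , p) , (z , x , q) , idp)) ((w , z , ρ) , (x , p , q) , e))
          (strict⇒Id (Σ̇ Tot N₂) (cong (λ q → (w , z , φ {f w} {g z} (x , p , q)) , (x , p , q) , idp) (moveʳ-idp q))) e)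

    F₁ : El Rel.cod → El Tot
    F₁ c = proj₁ (toN₁ c)
    F₂ : El Tgt.cod → El Tot
    F₂ c = proj₁ (toN₂ c)

    -- On `Kf` the middle edge repeats the first and both cancel, leaving the last; on `Kg` it
    -- repeats the last, leaving the first.
    hₗ : (k : El Kf) → El (Id Tot (F₁ (k , Δg (proj₁ k) , idp)) (F₂ (Tgt.h k)))
    hₗ (x , z , p) = ap (λ ρ → x , z , ρ) (zigzagˡ (gl x) (apl p) (gl z)
      (≡-trans (cong apr (moveˡ-idp idp)) (ap-idp inr)) (≡-trans (cong apr (moveʳ-idp idp)) (ap-idp inr)))

    hᵣ : (s : El Kg) → El (Id Tot (F₁ (Δf (proj₁ s) , s , idp)) (F₂ (Tgt.k s)))
    hᵣ (x , w , q) = ap (λ ρ → w , x , ρ) (zigzagʳ (gl w) (gl x)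
      (cong apr (≡-trans (moveˡ-idp q) (≡-sym (moveʳ-idp q)))) (ap-idp inl) (ap-idp inl))

    hₗ≈hᵣ : (x : El A) → El (hₗ (Δf x) ≈ hᵣ (Δg x))
    hₗ≈hᵣ x = ap {A = Id (Id P (inl (f x)) (inr (g x))) (ψ x (x , idp , moveˡ idp idp) ∙ gl x) (φ (x , idp , moveʳ idp idp))}
                 (ap {B = Tot} (λ ρ → x , x , ρ)) (zigzag-agree (gl x) (ap-idp inl)
                    (≡-trans (cong apr (moveˡ-idp idp)) (ap-idp inr))
                    (≡-trans (cong apr (moveʳ-idp idp)) (ap-idp inr))
                    (cong apr (≡-trans (moveˡ-idp idp) (≡-sym (moveʳ-idp idp)))))

    opaque
      m₁ : El Rel.dom → El Rel.cod
      m₁ = Rel.map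

      m₁-isContrMap : El (isContrMap Rel.dom Rel.cod Rel.map) → El (isEquiv Rel.dom Rel.cod m₁)
      m₁-isContrMap h = h

      m₁-inl : (k : El Kf) → m₁ (inl k) ≡ (k , Δg (proj₁ k) , idp)
      m₁-inl = rec-inl Rel.cod _ _ (λ _ → idp)

      m₁-inr : (s : El Kg) → m₁ (inr s) ≡ (Δf (proj₁ s) , s , idp)
      m₁-inr = rec-inr Rel.cod _ _ (λ _ → idp)

      m₁-glueInd : ∀ {c} (x : El A) (Ψ : (u v : El Rel.cod) → El (Id Rel.cod u v) →
          u ≡ (Δf x , Δg x , idp) → v ≡ (Δf x , Δg x , idp) → Type c) →
        El (Ψ (Δf x , Δg x , idp) (Δf x , Δg x , idp) idp refl refl) →
        El (Ψ (m₁ (inl (Δf x))) (m₁ (inr (Δg x))) (ap m₁ (glue x)) (m₁-inl (Δf x)) (m₁-inr (Δg x)))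
      m₁-glueInd = rec-glueInd Rel.cod (λ k → k , Δg (proj₁ k) , idp) (λ s → Δf (proj₁ s) , s , idp) (λ _ → idp)

      m₂ : El Rel.dom → El Tgt.cod
      m₂ = Tgt.map

      m₂-isContrMap : El (isContrMap Rel.dom Tgt.cod Tgt.map) → El (isEquiv Rel.dom Tgt.cod m₂)
      m₂-isContrMap h = h

      m₂-inl : (k : El Kf) → m₂ (inl k) ≡ Tgt.h k
      m₂-inl = rec-inl Tgt.cod Tgt.h Tgt.k (λ _ → idp)

      m₂-inr : (s : El Kg) → m₂ (inr s) ≡ Tgt.k s
      m₂-inr = rec-inr Tgt.cod Tgt.h Tgt.k (λ _ → idp)

      m₂-glueInd : ∀ {c} (x : El A) (Ψ : (u v : El Tgt.cod) → El (Id Tgt.cod u v) →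
          u ≡ (Δf x , Δg x , idp) → v ≡ (Δf x , Δg x , idp) → Type c) →
        El (Ψ (Δf x , Δg x , idp) (Δf x , Δg x , idp) idp refl refl) →
        El (Ψ (m₂ (inl (Δf x))) (m₂ (inr (Δg x))) (ap m₂ (glue x)) (m₂-inl (Δf x)) (m₂-inr (Δg x)))
      m₂-glueInd = rec-glueInd Tgt.cod Tgt.h Tgt.k (λ _ → idp)

    along : ∀ {u u′ v v′} → u ≡ u′ → v ≡ v′ → El (Id Tot (F₁ u′) (F₂ v′)) → El (Id Tot (F₁ u) (F₂ v))
    along refl refl h = h

    h-inl : ∀ k → El (Id Tot (F₁ (m₁ (inl k))) (F₂ (m₂ (inl k))))
    h-inl k = along (m₁-inl k) (m₂-inl k) (hₗ k)
    h-inr : ∀ s → El (Id Tot (F₁ (m₁ (inr s))) (F₂ (m₂ (inr s))))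
    h-inr s = along (m₁-inr s) (m₂-inr s) (hᵣ s)

    h-glue : ∀ x → El (Id (Id Tot (F₁ (m₁ (inl (Δf x)))) (F₂ (m₂ (inr (Δg x)))))
      (ap {A = Rel.cod} F₁ (ap {A = Rel.dom} m₁ (glue x)) ∙ h-inr (Δg x))
      (h-inl (Δf x) ∙ ap {A = Tgt.cod} F₂ (ap {A = Rel.dom} m₂ (glue x))))
    h-glue x = m₁-glueInd x
      (λ u v s i j → Id (Id Tot (F₁ u) (F₂ (m₂ (inr (Δg x)))))
        (ap {A = Rel.cod} F₁ s ∙ along j (m₂-inr (Δg x)) (hᵣ (Δg x)))
        (along i (m₂-inl (Δf x)) (hₗ (Δf x)) ∙ ap {A = Tgt.cod} F₂ (ap {A = Rel.dom} m₂ (glue x))))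
      (m₂-glueInd x
        (λ u v s i j → Id (Id Tot (F₁ c₁) (F₂ v))
          (ap {A = Rel.cod} F₁ (idp {x = c₁}) ∙ along refl j (hᵣ (Δg x)))
          (along refl i (hₗ (Δf x)) ∙ ap {A = Tgt.cod} F₂ s))
        base)
      where
        c₁ : El Rel.cod
        c₁ = Δf x , Δg x , idp
        c₂ : El Tgt.cod
        c₂ = Δf x , Δg x , idp
        base : El (Id (Id Tot (F₁ c₁) (F₂ c₂)) (ap {A = Rel.cod} F₁ (idp {x = c₁}) ∙ hᵣ (Δg x))
                      (hₗ (Δf x) ∙ ap {A = Tgt.cod} F₂ (idp {x = c₂})))
        base rewrite ap-idp {A = Rel.cod} {Tot} F₁ {c₁} | ap-idp {A = Tgt.cod} {Tot} F₂ {c₂} | trans-idp (hₗ (Δf x)) =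
          idp-trans (hᵣ (Δg x)) ∙ sym (hₗ≈hᵣ x)

    h-glue′ : ∀ x → El (Id (Id Tot (F₁ (m₁ (inl (Δf x)))) (F₂ (m₂ (inr (Δg x)))))
      (ap {A = Rel.dom} (λ u → F₁ (m₁ u)) (glue x) ∙ h-inr (Δg x)) (h-inl (Δf x) ∙ ap {A = Rel.dom} (λ u → F₂ (m₂ u)) (glue x)))
    h-glue′ x = (sym (ap-∘ F₁ m₁ (glue x)) ∙ʳ h-inr (Δg x)) ∙ h-glue x ∙ (h-inl (Δf x) ∙ˡ ap-∘ F₂ m₂ (glue x))

    h-over : ∀ x → El (Id (Id Tot (F₁ (m₁ (inr (Δg x)))) (F₂ (m₂ (inr (Δg x)))))
      (transport (λ u → Id Tot (F₁ (m₁ u)) (F₂ (m₂ u))) (glue x) (h-inl (Δf x))) (h-inr (Δg x)))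
    h-over x = transport-Id (λ u → F₁ (m₁ u)) (λ u → F₂ (m₂ u)) (glue x) (h-glue′ x)

    F₁~F₂ : (u : El Rel.dom) → El (Id Tot (F₁ (m₁ u)) (F₂ (m₂ u)))
    F₁~F₂ = Pushout-elim (λ u → Id Tot (F₁ (m₁ u)) (F₂ (m₂ u))) h-inl h-inr h-over

    F₁~F₂-inl : ∀ k → F₁~F₂ (inl k) ≡ h-inl k
    F₁~F₂-inl = Pushout-elim-inl (λ u → Id Tot (F₁ (m₁ u)) (F₂ (m₂ u))) h-inl h-inr h-over

    postcomposeEquiv : {x y z : El P} (r : El (Id P y z)) → El (Id P x y ≃ Id P x z)
    postcomposeEquiv r = mkEquiv (λ q → q ∙ r) (λ q → q ∙ sym r)
      (λ q → ∙-assoc q r (sym r) ∙ (q ∙ˡ ∙-sym r) ∙ ≡⇒≈ (trans-idp q))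
      (λ q → ∙-assoc q (sym r) r ∙ (q ∙ˡ sym-∙ r) ∙ ≡⇒≈ (trans-idp q))

    φ-onIdpʳ : ∀ {b z} (p : El (Id B b (f z))) → φ (z , p , idp {x = g z}) ≡ apl p ∙ gl z
    φ-onIdpʳ {z = z} p rewrite ap-idp {A = C} {P} inr {g z} | sym-idp {A = P} {inr (g z)} = trans-idp _

    proj₁-transport-N₂ : {x z : El A} {ρ ρ′ : El (Id P (inl (f x)) (inr (g z)))} (w : El (ρ ≈ ρ′)) (v : El (N₂ (x , z , ρ′))) →
      El (Id (Q (f x) (g z)) (proj₁ (transport N₂ (sym (ap {B = Tot} (λ ρ → x , z , ρ) w) ∙ idp) v)) (proj₁ v))
    proj₁-transport-N₂ {x} {z} {ρ} = J (λ ρ′ w → Π̇ (N₂ (x , z , ρ′)) λ v →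
        Id (Q (f x) (g z)) (proj₁ (transport N₂ (sym (ap {B = Tot} (λ ρ → x , z , ρ) w) ∙ idp) v)) (proj₁ v)) base
      where
        base : ∀ v → El (Id (Q (f x) (g z))
          (proj₁ (transport N₂ (sym (ap {A = Id P (inl (f x)) (inr (g z))} {B = Tot} (λ ρ → x , z , ρ) (idp {x = ρ})) ∙ idp) v))
          (proj₁ v))
        base v rewrite ap-idp {A = Id P (inl (f x)) (inr (g z))} {Tot} (λ ρ → x , z , ρ) {ρ}
                     | sym-idp {A = Tot} {x , z , ρ} | trans-idp (idp {A = Tot} {x , z , ρ})
                     = strict⇒Id (Q (f x) (g z)) (cong proj₁ (transport-idp {A = Tot} N₂ v))

    module _ (contractible : El (isContrMap Rel.dom Rel.cod Rel.map)) where
      τ₁ : El (Rel.dom ≃ Σ̇ Tot N₁)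
      τ₁ = compEquiv (m₁ , m₁-isContrMap contractible) κ₁

      τ₂ : El (Rel.dom ≃ Σ̇ Tot N₂)
      τ₂ = compEquiv (m₂ , m₂-isContrMap (joins⇒target-contractible (rel-contractible⇒joins contractible))) κ₂

      -- Unique filling of squares: when both wedge maps are equivalences, `Rel.dom` is the total
      -- space of either kind of zigzag, and `F₁~F₂` says that composites agree.
      N₁≃N₂ : ∀ t → El (N₁ t ≃ N₂ t)
      N₁≃N₂ = fiberwiseEquiv Rel.dom Tot N₁ N₂ τ₁ τ₂ F₁~F₂

      exchange : ∀ t → El (N₁ t) → El (N₂ t)
      exchange t = proj₁ (N₁≃N₂ t)

      exchange-inl : (k : El Kf) → let c = k , Δg (proj₁ k) , idp in
        El (Id (N₂ (F₁ c)) (exchange (F₁ c) (proj₂ (toN₁ c))) (transport N₂ (sym (hₗ k) ∙ idp) (proj₂ (toN₂ (Tgt.h k)))))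
      exchange-inl k = strip (m₁-inl k) (m₂-inl k) (F₁~F₂-inl k)
        (fiberwiseEquiv-point Rel.dom Tot N₁ N₂ τ₁ τ₂ F₁~F₂ (inl k))
        where
          strip : ∀ {u v} (i : u ≡ (k , Δg (proj₁ k) , idp)) (j : v ≡ Tgt.h k) {h : El (Id Tot (F₁ u) (F₂ v))} →
            h ≡ along i j (hₗ k) →
            El (Id (N₂ (F₁ u)) (exchange (F₁ u) (proj₂ (toN₁ u))) (transport N₂ (sym h ∙ idp) (proj₂ (toN₂ v)))) →
            El (Id (N₂ (F₁ (k , Δg (proj₁ k) , idp)))
                   (exchange (F₁ (k , Δg (proj₁ k) , idp)) (proj₂ (toN₁ (k , Δg (proj₁ k) , idp))))
                   (transport N₂ (sym (hₗ k) ∙ idp) (proj₂ (toN₂ (Tgt.h k)))))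
          strip refl refl refl w = w

      -- If the middle edge repeats the first, the filler is the last edge.
      exchange-path : (k : El Kf) → let (x , z , p) = k in
        El (Id (Q (f x) (g z)) (proj₁ (exchange (x , z , ψ x (x , p , idp) ∙ gl z) ((x , p , idp) , idp))) (z , p , idp))
      exchange-path k@(x , z , p) =
        subst₂ (λ q q′ → El (Id (Q (f x) (g z)) (proj₁ (exchange (x , z , ψ x (x , p , q) ∙ gl z) ((x , p , q) , idp))) (z , p , q′)))
          (moveˡ-idp idp) (moveʳ-idp idp)
          (ap {A = N₂ (F₁ (k , Δg x , idp))} proj₁ (exchange-inl k) ∙ proj₁-transport-N₂ _ (proj₂ (toN₂ (Tgt.h k))))

      module _ (x : El A) where
        Mₗ : (b : El B) → El (Id P (inl (f x)) (inl b)) → Type ℓ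
        Mₗ b q = fiber (R x b) (Id P (inl (f x)) (inl b)) (ψ x) q

        Mᵣ : (c : El C) → El (Id P (inl (f x)) (inr c)) → Type ℓ
        Mᵣ c q = fiber (Q (f x) c) (Id P (inl (f x)) (inr c)) φ q

        -- Appending the edge z turns zigzags of length two into zigzags of length three, which
        -- `N₁≃N₂` shortens to one edge; composing with `gl z` loses nothing.
        Mₗ≃Mᵣ : ∀ z q → El (Mₗ (f z) q ≃ Mᵣ (g z) (q ∙ gl z))
        Mₗ≃Mᵣ z q = compEquiv
          (Σ-equiv (R x (f z)) (λ n → ψ x n ≈ q) (λ n → ψ x n ∙ gl z ≈ q ∙ gl z) (λ n → Id-equiv (postcomposeEquiv (gl z)) (ψ x n) q))
          (N₁≃N₂ (x , z , q ∙ gl z))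

        -- The edge x traversed forth and back.
        start : El (Mₗ (f x) idp)
        start = (x , idp , idp) , lem
          where
            lem : El (gl x ∙ sym (apr (idp {x = g x})) ∙ sym (gl x) ∙ apl (idp {x = f x}) ≈ idp)
            lem rewrite ap-idp {A = C} {P} inr {g x} | ap-idp {A = B} {P} inl {f x} | sym-idp {A = P} {inr (g x)}
                      | trans-idp (gl x) | trans-idp (gl x ∙ sym (gl x)) = ∙-sym (gl x)

        open PushoutPathInduction A B C f g (f x)

        sₗ : ∀ b q → El (Mₗ b q)
        sₗ = sectionₗ Mₗ Mᵣ Mₗ≃Mᵣ start
        sᵣ : ∀ c q → El (Mᵣ c q)
        sᵣ = sectionᵣ Mₗ Mᵣ Mₗ≃Mᵣ start

        sₗ-apl : ∀ {b} (p : El (Id B (f x) b)) → El (Id (R x b) (proj₁ (sₗ b (apl p))) (x , p , idp))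
        sₗ-apl = J (λ b p → Id (R x b) (proj₁ (sₗ b (apl p))) (x , p , idp)) base
          where
            base : El (Id (R x (f x)) (proj₁ (sₗ (f x) (apl idp))) (x , idp , idp))
            base = subst (λ q → El (Id (R x (f x)) (proj₁ (sₗ (f x) q)) (x , idp , idp))) (≡-sym (ap-idp inl))
              (strict⇒Id (R x (f x)) (cong proj₁ (sectionₗ-idp Mₗ Mᵣ Mₗ≃Mᵣ start)))

        -- The composite of the edge z is `apl p ∙ gl z`, so `sectionᵣ-glue` expresses the value
        -- there as the filler of the value at `apl p` followed by z. That value is the edge x forth
        -- and back, and `exchange-path` returns z.
        sᵣ-φ : ∀ {c} (d : El (Q (f x) c)) → El (Id (Q (f x) c) (proj₁ (sᵣ c (φ d))) d)
        sᵣ-φ (z , p , s) = J⁻ (λ c s → Id (Q (f x) c) (proj₁ (sᵣ c (φ (z , p , s)))) (z , p , s)) base s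
          where
            exchange-from : ∀ n → El (Id (R x (f z)) (x , p , idp) n) → ∀ {ρ} (w : El (ψ x n ∙ gl z ≈ ρ)) →
                            El (Id (Q (f x) (g z)) (proj₁ (exchange (x , z , ρ) (n , w))) (z , p , idp))
            exchange-from n π {ρ} w = J (λ ρ w → Id (Q (f x) (g z)) (proj₁ (exchange (x , z , ρ) (n , w))) (z , p , idp))
              (J (λ n _ → Id (Q (f x) (g z)) (proj₁ (exchange (x , z , ψ x n ∙ gl z) (n , idp))) (z , p , idp))
                 (exchange-path (x , z , p)) π) w
            base : El (Id (Q (f x) (g z)) (proj₁ (sᵣ (g z) (φ (z , p , idp)))) (z , p , idp))
            base = subst (λ q → El (Id (Q (f x) (g z)) (proj₁ (sᵣ (g z) q)) (z , p , idp))) (≡-sym (φ-onIdpʳ p))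
              (ap {A = Mᵣ (g z) (apl p ∙ gl z)} proj₁ (sectionᵣ-glue Mₗ Mᵣ Mₗ≃Mᵣ start z (apl p))
               ∙ exchange-from (proj₁ (sₗ (f z) (apl p))) (sym (sₗ-apl p)) _)

        φ-isEquiv : ∀ c → El (isEquiv (Q (f x) c) (Id P (inl (f x)) (inr c)) φ)
        φ-isEquiv c = quasiInverse⇒isEquiv φ (λ q → proj₁ (sᵣ c q)) sᵣ-φ (λ q → proj₂ (sᵣ c q))

      Cone : Type ℓ
      Cone = Pullback B C P inl inr

      fiberφ : El Cone → Type ℓ
      fiberφ (b , c , q) = fiber (Q b c) (Id P (inl b) (inr c)) φ q

      φ-idp : ∀ x → El (φ (x , idp {x = f x} , idp {x = g x}) ≈ gl x)
      φ-idp x = ≡⇒≈ (≡-trans (φ-onIdpʳ idp) (cong (λ p → p ∙ gl x) (ap-idp inl))) ∙ idp-trans (gl x)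

      -- In the total space of `fiberφ`, the composite q and the end points b and c each form a
      -- singleton with their witness, so only the edge in `A` remains.
      gap-fiber : ∀ d → El (fiber A Cone (gap A B C f g) d ≃ fiberφ d)
      gap-fiber = fiberEquiv A Cone fiberφ (gap A B C f g) point
        (quasiInverse⇒isEquiv (λ x → gap A B C f g x , point x) (λ (_ , (x , _) , _) → x) (λ _ → idp) roundtrip)
        where
          point : ∀ x → El (fiberφ (gap A B C f g x))
          point x = (x , idp , idp) , φ-idp x
          Σfiberφ : Type ℓ
          Σfiberφ = Σ̇ Cone fiberφ
          roundtrip : (w : El Σfiberφ) → let x = proj₁ (proj₁ (proj₂ w)) in El (Id Σfiberφ (gap A B C f g x , point x) w)
          roundtrip ((b , c , q) , (x , p , s) , w) =
            J (λ q w → Id Σfiberφ (gap A B C f g x , point x) ((b , c , q) , (x , p , s) , w))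
              (J⁻ (λ b p → Id Σfiberφ (gap A B C f g x , point x) ((b , c , φ (x , p , s)) , (x , p , s) , idp))
                (J⁻ (λ c s → Id Σfiberφ (gap A B C f g x , point x) ((f x , c , φ (x , idp , s)) , (x , idp , s) , idp))
                  (J (λ q w → Id Σfiberφ ((f x , g x , q) , (x , idp , idp) , w)
                                         ((f x , g x , φ (x , idp , idp)) , (x , idp , idp) , idp))
                     idp (φ-idp x)) s) p) w

      GapContractible : El B → Type ℓ
      GapContractible b = Π̇ C λ c → Π̇ (Id P (inl b) (inr c)) λ q → isContr (fiber A Cone (gap A B C f g) (b , c , q))

      isProp-GapContractible : ∀ b → El (isProp (GapContractible b))
      isProp-GapContractible b = isProp-Π C _ λ c → isProp-Π (Id P (inl b) (inr c)) _ λ q → isProp-isContr _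

      gapContractible-image : ∀ x → El (GapContractible (f x))
      gapContractible-image x c q = isContr-equiv _ _ (gap-fiber (f x , c , q)) (φ-isEquiv x c q)

      -- Path induction was based at points f x, and b need not be of this form. The family `Z` is
      -- the claim on B and `𝟙` on C, glued by the claim for f x; transporting `tt` back along q
      -- proves the claim for b.
      cartesian : El (isCartesianPushoutSquare A B C f g)
      cartesian (b , c , q) = subst El (rec-inl (𝒰 ℓ) GapContractible (λ _ → 𝟙) image b)
        (coe (sym (ap Z q)) (subst El (≡-sym (rec-inr (𝒰 ℓ) GapContractible (λ _ → 𝟙) image c)) tt)) c q
        where
          image : ∀ x → El (Id (𝒰 ℓ) (GapContractible (f x)) 𝟙)
          image x = propositionalExtensionality (isProp-GapContractible (f x)) (λ _ _ → idp)
            (λ _ → tt) (λ _ → gapContractible-image x)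
          Z : El P → Type ℓ
          Z = Pushout-rec (𝒰 ℓ) GapContractible (λ _ → 𝟙) image

theorem4p12 :
  (H : HoTT) → let open Homotopy H in
    ∀ {ℓ} → El (PlusPrinciple ℓ) →
    (A B C : Type ℓ) (f : El A → El B) (g : El A → El C) →
    let module Rel = RelativeDiagonalPushoutProduct A B C f g
        module Abs = PushoutProduct A (KernelPair A B f) A (KernelPair A C g) (Δ A B f) (Δ A C g)
    in
    (El (isAcyclicMap Rel.dom Rel.cod Rel.map) ⇔ El (isContrMap Rel.dom Rel.cod Rel.map))
    × (El (isAcyclicMap Rel.dom Rel.cod Rel.map) → El (isCartesianPushoutSquare A B C f g))
    × (El (isAcyclicMap Abs.dom Abs.cod Abs.map) → El (isCartesianPushoutSquare A B C f g))
theorem4p12 H plus A B C f g =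
  mk⇔ (λ acyclic → joins⇒rel-contractible (rel-acyclic⇒joins plus acyclic))
      (λ contractible c → contractible⇒acyclic _ (contractible c)) ,
  (λ acyclic → cartesian (joins⇒rel-contractible (rel-acyclic⇒joins plus acyclic))) ,
  (λ acyclic → cartesian (joins⇒rel-contractible (abs-acyclic⇒joins plus acyclic)))
  where
    open Development H
    open Connectivity A B C f g
    open BlakersMassey A B C f g
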